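{- Let $\Pi_1,\Pi_2$ be hereditary graph classes whose associated forbidden families $\mathcal F_1,\mathcal F_2$ are both finite, and suppose that for a fixed integer $\alpha$ the path $P_\alpha$ on $\alpha$ vertices belongs to $\mathcal F_1$. For $i\in\{1,2\}$ let $d_i$ be the maximum number of vertices of a graph in $\mathcal F_i$, and let $c=d_1+d_2+\alpha-2$. Then there is an algorithm that, given an undirected graph $G$ on $n$ vertices and an integer $k$, decides in time $c^k\cdot n^{O(1)}$ whether there is a set $S\subseteq V(G)$ of at most $k$ vertices such that every connected component of $G-S$ is in $\Pi_1$ or in $\Pi_2$.
   Context: All graphs are finite, simple and undirected. A graph class is hereditary if it is closed under taking induced subgraphs. For $i\in\{1,2\}$, the forbidden family $\mathcal F_i$ associated to $\Pi_i$ is a family of graphs such that a graph has all of its connected components in $\Pi_i$ if and only if it contains no member of $\mathcal F_i$ as an induced subgraph. It is assumed throughout that all graphs in $\mathcal F_1$ and $\mathcal F_2$ are connected. Different components of $G-S$ may belong to different classes. The families $\mathcal F_1,\mathcal F_2$ and $\alpha$ are fixed (not part of the input). -}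

module Defs where

open import Data.Bool.Base using (Bool; true; false; _∨_)
open import Data.Bool.Properties using (∨-comm; ∨-idem)
open import Data.Fin.Base using (Fin; zero; suc; toℕ)
open import Data.Fin.Subset using (Subset; inside; outside; _∈_; ∣_∣; ∁)
open import Data.List.Base as List using (List; []; _∷_)
open import Data.List.Relation.Unary.All using (All)
open import Data.List.Relation.Unary.Any using (Any)
open import Data.Nat.Base using (ℕ; zero; suc; _+_; _≤_; _≡ᵇ_)
open import Data.Product.Base using (Σ; ∃-syntax; _×_; _,_)
open import Data.Sum.Base using (_⊎_)
open import Data.Vec.Base as Vec using (Vec; []; _∷_)
open import Function.Bundles using (_⇔_; _↣_; _↔_; module Injection; module Inverse)
open import Level using (Level; _⊔_)
open import Relation.Binary.Construct.Closure.ReflexiveTransitive using (Star)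
open import Relation.Binary.PropositionalEquality using (_≡_; refl; trans)
open import Relation.Nullary.Negation.Core using (¬_)
open import Relation.Nullary.Reflects using (Reflects)
open import Relation.Unary using (Pred)

private variable
  ℓ ℓ₁ ℓ₂ : Level
  m n : ℕ

------------------------------------------------------------------------
-- Graphs

record Graph : Set where
  field
    order      : ℕ
    adj        : Fin order → Fin order → Bool
    adj-sym    : ∀ u v → adj u v ≡ adj v u
    adj-irrefl : ∀ v → adj v v ≡ false

  Vertex : Set
  Vertex = Fin order

  Adjacent : Vertex → Vertex → Set
  Adjacent u v = adj u v ≡ true

  Reachable : Vertex → Vertex → Set
  Reachable = Star Adjacent

open Graph using (order; adj; Vertex; Reachable)

_≅_ : Graph → Graph → Set
H ≅ G = Σ (Vertex H ↔ Vertex G) λ f → let open Inverse f in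
  ∀ u v → adj H u v ≡ adj G (to u) (to v)

-- H is isomorphic to an induced subgraph of G.
_≤ᵢ_ : Graph → Graph → Set
H ≤ᵢ G = Σ (Vertex H ↣ Vertex G) λ f → let open Injection f in
  ∀ u v → adj H u v ≡ adj G (to u) (to v)

-- The increasing enumeration of the elements of a subset.
element : (p : Subset n) → Fin ∣ p ∣ → Fin n
element (inside  ∷ p) zero    = zero
element (inside  ∷ p) (suc i) = suc (element p i)
element (outside ∷ p) i       = suc (element p i)

_[_] : (G : Graph) → Subset (order G) → Graph
G [ p ] = record
  { order      = ∣ p ∣
  ; adj        = λ u v → adj G (element p u) (element p v)
  ; adj-sym    = λ u v → Graph.adj-sym G (element p u) (element p v)
  ; adj-irrefl = λ v → Graph.adj-irrefl G (element p v)
  }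

_-_ : (G : Graph) → Subset (order G) → Graph
G - S = G [ ∁ S ]

Connected : Graph → Set
Connected G = Vertex G × (∀ u v → Reachable G u v)

IsComponent : (G : Graph) → Subset (order G) → Set
IsComponent G C = ∃[ v ] ∀ w → w ∈ C ⇔ Reachable G v w

path : ℕ → Graph
path k = record
  { order      = k
  ; adj        = λ u v → next u v ∨ next v u
  ; adj-sym    = λ u v → ∨-comm (next u v) (next v u)
  ; adj-irrefl = λ v → trans (∨-idem (next v v)) (1+n≢ᵇn (toℕ v))
  }
  where
  next : Fin k → Fin k → Bool
  next u v = suc (toℕ u) ≡ᵇ toℕ v

  1+n≢ᵇn : ∀ i → (suc i ≡ᵇ i) ≡ false
  1+n≢ᵇn zero    = refl
  1+n≢ᵇn (suc i) = 1+n≢ᵇn i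

------------------------------------------------------------------------
-- Graph classes and forbidden families

GraphClass : (ℓ : Level) → Set (Level.suc ℓ)
GraphClass ℓ = Pred Graph ℓ

-- _≤ᵢ_ is up to isomorphism, so this includes closure under isomorphism.
Hereditary : GraphClass ℓ → Set ℓ
Hereditary Π = ∀ {H G} → H ≤ᵢ G → Π G → Π H

EachComponent : GraphClass ℓ → GraphClass ℓ
EachComponent Π G = ∀ C → IsComponent G C → Π (G [ C ])

-- A finite family of graphs, up to isomorphism, is a list; its members
-- need not be minimal.
IsForbiddenFamily : GraphClass ℓ → List Graph → Set ℓ
IsForbiddenFamily Π 𝓕 = ∀ G → EachComponent Π G ⇔ All (λ H → ¬ (H ≤ᵢ G)) 𝓕

_∈≅_ : Graph → List Graph → Set
H ∈≅ 𝓕 = Any (H ≅_) 𝓕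

IsMaxOrder : List Graph → ℕ → Set
IsMaxOrder 𝓕 d = Any (λ H → order H ≡ d) 𝓕 × All (λ H → order H ≤ d) 𝓕

HasDeletionSet : GraphClass ℓ₁ → GraphClass ℓ₂ → Graph × ℕ → Set (ℓ₁ ⊔ ℓ₂)
HasDeletionSet Π₁ Π₂ (G , k) =
  ∃[ S ] ∣ S ∣ ≤ k × EachComponent (λ H → Π₁ H ⊎ Π₂ H) (G - S)

------------------------------------------------------------------------
-- Algorithms and running time
--
-- Algorithms are programs of a first-order, call-by-value language over
-- binary trees with mutually recursive unary functions (Jones's language F
-- with pattern matching).  Every evaluation rule costs one unit and is a
-- bounded number of pointer operations for a fixed program: trees are
-- shared, never copied, and there is no equality test on trees.  Hence t
-- units take O(t) operations on a RAM or a pointer machine.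

data Tree : Set where
  nil : Tree
  _∙_ : Tree → Tree → Tree

-- Expr m n: expressions over m functions, with n variables (de Bruijn
-- indices) in scope.
data Expr (m : ℕ) : ℕ → Set where
  var    : Fin n → Expr m n
  nil    : Expr m n
  cons   : Expr m n → Expr m n → Expr m n
  -- In the second branch, index 0 is the left subtree and index 1 the right.
  match  : Expr m n → Expr m n → Expr m (2 + n) → Expr m n
  letin  : Expr m n → Expr m (1 + n) → Expr m n
  call   : Fin m → Expr m n → Expr m n

record Program : Set where
  field
    size   : ℕ
    bodies : Vec (Expr size 1) size
    main   : Expr size 1

module _ (bodies : Vec (Expr m 1) m) where

  -- Eval ρ e v t: in environment ρ, e evaluates to v in t units of time.
  data Eval {n} (ρ : Vec Tree n) : Expr m n → Tree → ℕ → Set where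
    var : ∀ i → Eval ρ (var i) (Vec.lookup ρ i) 1
    nil : Eval ρ nil nil 1
    cons : ∀ {e₁ e₂ v₁ v₂ t₁ t₂} →
      Eval ρ e₁ v₁ t₁ → Eval ρ e₂ v₂ t₂ →
      Eval ρ (cons e₁ e₂) (v₁ ∙ v₂) (1 + t₁ + t₂)
    match-nil : ∀ {e e₁ e₂ v t t₁} →
      Eval ρ e nil t → Eval ρ e₁ v t₁ →
      Eval ρ (match e e₁ e₂) v (1 + t + t₁)
    match-cons : ∀ {e e₁ e₂ l r v t t₂} →
      Eval ρ e (l ∙ r) t → Eval (l ∷ r ∷ ρ) e₂ v t₂ →
      Eval ρ (match e e₁ e₂) v (1 + t + t₂)
    letin : ∀ {e₁ e₂ v₁ v t₁ t₂} →
      Eval ρ e₁ v₁ t₁ → Eval (v₁ ∷ ρ) e₂ v t₂ →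
      Eval ρ (letin e₁ e₂) v (1 + t₁ + t₂)
    call : ∀ {f e a v t₁ t₂} →
      Eval ρ e a t₁ → Eval (a ∷ []) (Vec.lookup bodies f) v t₂ →
      Eval ρ (call f e) v (1 + t₁ + t₂)

Run : Program → Tree → Tree → ℕ → Set
Run p a v t = Eval bodies (a ∷ []) main v t
  where open Program p

encodeBool : Bool → Tree
encodeBool false = nil
encodeBool true  = nil ∙ nil

encodeList : List Tree → Tree
encodeList []       = nil
encodeList (x ∷ xs) = x ∙ encodeList xs

-- Unary.
encodeℕ : ℕ → Tree
encodeℕ k = encodeList (List.replicate k nil)

-- The adjacency matrix, as the list of its rows.
encodeGraph : Graph → Tree
encodeGraph G = encodeList (List.tabulate λ u →
  encodeList (List.tabulate λ v → encodeBool (adj G u v)))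

encodeInstance : Graph × ℕ → Tree
encodeInstance (G , k) = encodeGraph G ∙ encodeℕ k

DecidesInTime : {I : Set} → (I → Tree) → Program → Pred I ℓ → (I → ℕ) → Set ℓ
DecidesInTime encode p P T = ∀ x →
  ∃[ b ] ∃[ t ] Run p (encode x) (encodeBool b) t × t ≤ T x × Reflects (P x) b

{-# OPTIONS --safe #-}
module Submission where

-- Call a tuple of c vertices of G bad if its entries induce a connected
-- subgraph that contains a member of 𝓕₁ and a member of 𝓕₂.  The deletion
-- sets of G are exactly the sets that hit every bad tuple.
--
-- If S misses a bad tuple, then the component of G - S that contains the
-- tuple has induced subgraphs in both families, so it is in neither class
-- (each⇒hit).  Conversely, suppose that a component K of G - S is in
-- neither class, so that K contains some H₁ in 𝓕₁ and some H₂ in 𝓕₂.  Take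
-- a geodesic of K from a vertex v of H₂ to a vertex of H₁.  If it has α
-- edges or more, then its first α vertices induce a path, which is in 𝓕₁
-- and can replace H₁.  In both cases some member of 𝓕₁ in K is joined to v
-- by a walk of l < α edges (shortWalk).  That member, the walk and H₂
-- together have at most d₁ + l + (d₂ - 1) ≤ c vertices, because the walk
-- shares its first vertex with H₂ and its last vertex with the member; and
-- they induce a connected subgraph.  Repeating entries gives a bad tuple
-- that S misses (connected⇒bad, hit⇒each).
--
-- Whether a tuple is bad depends only on which of its entries are equal and
-- which are adjacent.  As c is fixed, this is a fixed Boolean function of
-- c * c pairs of bits, and the program contains its decision tree.  The
-- program lists the n ^ c tuples of vertices, keeps the bad ones, and then
-- looks for a hitting set of size at most k by branching over the c entries
-- of a tuple that is not hit yet (hittable).  The search tree has depth at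
-- most k and each of its nodes takes polynomial time, which adds up to
-- (k + 1) * branchT n * c ^ k (solveT-bound).  If n ≤ k, then the set of all
-- vertices is a solution and the program accepts at once; otherwise the
-- factor k + 1 is at most n.

open import Defs
open import Data.Bool.Base using (Bool; true; false; _∨_; not; T)
import Data.Bool.Properties as Bool
open import Data.Empty using (⊥-elim)
open import Data.Fin.Base using (Fin; zero; suc; toℕ; fromℕ; fromℕ<; combine; punchIn; punchOut)
open import Data.Fin.Patterns
open import Data.Fin.Properties using (_≟_; any?; all?; toℕ-injective; toℕ<n; punchIn-punchOut)
open import Data.Fin.Subset as Subset using (Subset; inside; outside; _∈_; ∣_∣; ∁; ⊤)
open import Data.Fin.Subset.Properties using (_∈?_; ∈⊤; ∣⊤∣≡n; ∣⊥∣≡0; x∈∁p⇒x∉p; x∉p⇒x∈∁p; x∈p⇒∣p-x∣<∣p∣; x∈p∧x≢y⇒x∈p-y)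
open import Data.List.Base as List using (List; []; _∷_; _++_; length; cartesianProductWith; filterᵇ)
open import Data.List.Membership.Propositional using (find; lose) renaming (_∈_ to _∈ˡ_)
open import Data.List.Membership.Propositional.Properties using (∈-++⁺ˡ; ∈-++⁺ʳ; ∈-++⁻; ∈-tabulate⁺; ∈-tabulate⁻; ∈-map⁺; ∈-map⁻; ∈-allFin; ∈-filter⁺; ∈-filter⁻; ∈-cartesianProductWith⁺)
open import Data.List.Properties using (length-++; length-map; length-tabulate; length-filter; map-tabulate)
open import Data.List.Relation.Unary.All as All using (All)
open import Data.List.Relation.Unary.All.Properties using (¬Any⇒All¬; All¬⇒¬Any)
open import Data.List.Relation.Unary.Any as Any using (Any; here; there)
open import Data.Nat.Base using (ℕ; zero; suc; pred; _+_; _*_; _∸_; _^_; _⊔_; _≤_; _<_; _≡ᵇ_; _≤ᵇ_; z≤n; s≤s; NonZero; >-nonZero; >-nonZero⁻¹)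
open import Data.Nat.ListAction using (sum)
open import Data.Nat.ListAction.Properties using (sum-++)
import Data.Nat.Properties as ℕ
open import Data.Nat.Solver using (module +-*-Solver)
open import Data.Product.Base using (∃; ∃-syntax; _×_; _,_; proj₁; proj₂)
open import Data.Sum.Base as Sum using (_⊎_; inj₁; inj₂)
open import Data.Vec.Base as Vec using (Vec; []; _∷_; lookup; toList)
open import Data.Vec.Properties using (lookup-replicate; lookup∘tabulate; lookup-map; lookup-concat; []=⇒lookup; lookup⇒[]=)
open import Function.Base using (_∘_; id; case_of_)
open import Function.Bundles using (mk⇔; mk↣; module Equivalence; module Injection; module Inverse)
open import Level using (0ℓ)
open import Relation.Binary.Construct.Closure.ReflexiveTransitive as Star using (Star; ε; _◅_; _◅◅_)
open import Relation.Binary.Core using (Rel)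
open import Relation.Binary.Definitions using (Decidable)
open import Relation.Binary.PropositionalEquality using (_≡_; _≢_; refl; sym; trans; cong; cong₂; subst)
open import Relation.Nullary.Decidable using (Dec; yes; no; does; True; toWitness; map′; _×-dec_; _⊎-dec_; _→-dec_; dec-true)
open import Relation.Nullary.Negation using (¬_; contradiction)
open import Relation.Nullary.Reflects using (Reflects; ofʸ; ofⁿ)

open Graph using (order; adj; adj-sym; adj-irrefl; Vertex; Adjacent; Reachable)

private variable
  m n c : ℕ

------------------------------------------------------------------------
-- Decidability over finite sets

does-true : ∀ {A : Set} (A? : Dec A) → does A? ≡ true → A
does-true (yes a) _ = a

module _ {R : Rel (Fin n) 0ℓ} (R? : Decidable R) where

  -- Via L u v: v can be reached from u by R-steps whose intermediate
  -- vertices lie in L.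
  Via : List (Fin n) → Fin n → Fin n → Set
  Via []      u v = u ≡ v ⊎ R u v
  Via (w ∷ L) u v = Via L u v ⊎ (Via L u w × Via L w v)

  via? : ∀ L u v → Dec (Via L u v)
  via? []      u v = u ≟ v ⊎-dec R? u v
  via? (w ∷ L) u v = via? L u v ⊎-dec (via? L u w ×-dec via? L w v)

  via⇒star : ∀ L {u v} → Via L u v → Star R u v
  via⇒star []      (inj₁ refl)    = ε
  via⇒star []      (inj₂ r)       = r ◅ ε
  via⇒star (w ∷ L) (inj₁ p)       = via⇒star L p
  via⇒star (w ∷ L) (inj₂ (p , q)) = via⇒star L p ◅◅ via⇒star L q

  via-refl : ∀ L {u} → Via L u u
  via-refl []      = inj₁ refl
  via-refl (w ∷ L) = inj₁ (via-refl L)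

  via-step : ∀ L {u v} → R u v → Via L u v
  via-step []      r = inj₂ r
  via-step (w ∷ L) r = inj₁ (via-step L r)

  -- Via L is transitive through the vertices of L only, but this suffices
  -- once L contains every vertex.
  via-trans : ∀ {L u w v} → w ∈ˡ L → Via L u w → Via L w v → Via L u v
  via-trans {w ∷ L} {u} {.w} {v} (here refl) p q = inj₂ (fromStart p , toEnd q)
    where
    fromStart : Via (w ∷ L) u w → Via L u w
    fromStart (inj₁ p)       = p
    fromStart (inj₂ (p , _)) = p
    toEnd : Via (w ∷ L) w v → Via L w v
    toEnd (inj₁ q)       = q
    toEnd (inj₂ (_ , q)) = q
  via-trans (there w∈L) (inj₁ p)       (inj₁ q)       = inj₁ (via-trans w∈L p q)
  via-trans (there w∈L) (inj₁ p)       (inj₂ (q , r)) = inj₂ (via-trans w∈L p q , r)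
  via-trans (there w∈L) (inj₂ (p , q)) (inj₁ r)       = inj₂ (p , via-trans w∈L q r)
  via-trans (there w∈L) (inj₂ (p , _)) (inj₂ (_ , r)) = inj₂ (p , r)

  star⇒via : ∀ {u v} → Star R u v → Via (List.allFin n) u v
  star⇒via ε        = via-refl _
  star⇒via (r ◅ rs) = via-trans (∈-allFin _) (via-step _ r) (star⇒via rs)

  star? : Decidable (Star R)
  star? u v = map′ (via⇒star _) star⇒via (via? (List.allFin n) u v)

anyVec? : ∀ m {P : Vec (Fin n) m → Set} → (∀ xs → Dec (P xs)) → Dec (∃ P)
anyVec? zero    P? = map′ (λ p → [] , p) (λ { ([] , p) → p }) (P? [])
anyVec? (suc m) P? =
  map′ (λ { (x , xs , p) → x ∷ xs , p }) (λ { (x ∷ xs , p) → x , xs , p })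
       (any? λ x → anyVec? m λ xs → P? (x ∷ xs))

module _ {P : ℕ → Set} (P? : ∀ k → Dec (P k)) where

  Least : ℕ → Set
  Least k = P k × (∀ {i} → i < k → ¬ P i)

  leastBelow : ∀ k → ∃ Least ⊎ (∀ {i} → i < k → ¬ P i)
  leastBelow zero    = inj₂ λ ()
  leastBelow (suc k) with leastBelow k
  ... | inj₁ found = inj₁ found
  ... | inj₂ none with P? k
  ...   | yes p = inj₁ (k , p , none)
  ...   | no ¬p = inj₂ λ i<1+k → case ℕ.m<1+n⇒m<n∨m≡n i<1+k of λ where
    (inj₁ i<k)  → none i<k
    (inj₂ refl) → ¬p

  least : ∀ {k} → P k → ∃ Least
  least {k} p with leastBelow (suc k)
  ... | inj₁ found = found
  ... | inj₂ none  = contradiction p (none (ℕ.n<1+n k))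

------------------------------------------------------------------------
-- Induced subgraphs

element-∈ : (p : Subset n) (i : Fin ∣ p ∣) → element p i ∈ p
element-∈ (inside  ∷ p) zero    = Vec.here
element-∈ (inside  ∷ p) (suc i) = Vec.there (element-∈ p i)
element-∈ (outside ∷ p) i       = Vec.there (element-∈ p i)

index : (p : Subset n) {x : Fin n} → x ∈ p → ∃ λ i → element p i ≡ x
index (inside  ∷ p) Vec.here        = zero , refl
index (inside  ∷ p) (Vec.there x∈p) = let i , eq = index p x∈p in suc i , cong suc eq
index (outside ∷ p) (Vec.there x∈p) = let i , eq = index p x∈p in i , cong suc eq

-- Stated for the Boolean equality test, because patterns record its value.
element-≡ᵇ : (p : Subset n) (i j : Fin ∣ p ∣) →
             (toℕ i ≡ᵇ toℕ j) ≡ (toℕ (element p i) ≡ᵇ toℕ (element p j))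
element-≡ᵇ (inside  ∷ p) zero    zero    = refl
element-≡ᵇ (inside  ∷ p) zero    (suc j) = refl
element-≡ᵇ (inside  ∷ p) (suc i) zero    = refl
element-≡ᵇ (inside  ∷ p) (suc i) (suc j) = element-≡ᵇ p i j
element-≡ᵇ (outside ∷ p) i       j       = element-≡ᵇ p i j

≡⇒≡ᵇ : {i j : Fin n} → i ≡ j → (toℕ i ≡ᵇ toℕ j) ≡ true
≡⇒≡ᵇ {i = i} refl = Bool.T-≡ .Equivalence.to (ℕ.≡⇒≡ᵇ (toℕ i) (toℕ i) refl)

≡ᵇ⇒≡ : {i j : Fin n} → (toℕ i ≡ᵇ toℕ j) ≡ true → i ≡ j
≡ᵇ⇒≡ {i = i} {j} eq = toℕ-injective (ℕ.≡ᵇ⇒≡ (toℕ i) (toℕ j) (Bool.T-≡ .Equivalence.from eq))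

element-injective : (p : Subset n) {i j : Fin ∣ p ∣} → element p i ≡ element p j → i ≡ j
element-injective p {i} {j} eq = ≡ᵇ⇒≡ (trans (element-≡ᵇ p i j) (≡⇒≡ᵇ eq))

-- f is an isomorphism from H to an induced subgraph of G.
record IsEmbedding (H G : Graph) (f : Vertex H → Vertex G) : Set where
  field
    injective : ∀ {u v} → f u ≡ f v → u ≡ v
    preserves : ∀ u v → adj H u v ≡ adj G (f u) (f v)

open IsEmbedding

embedding⇒≤ᵢ : ∀ {H G f} → IsEmbedding H G f → H ≤ᵢ G
embedding⇒≤ᵢ e = mk↣ (injective e) , preserves e

≤ᵢ⇒embedding : ∀ {H G} (i : H ≤ᵢ G) → IsEmbedding H G (Injection.to (proj₁ i))
≤ᵢ⇒embedding (f , pres) = record { injective = Injection.injective f ; preserves = pres }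

[]-≤ᵢ : ∀ G p → (G [ p ]) ≤ᵢ G
[]-≤ᵢ G p = embedding⇒≤ᵢ {G [ p ]} {G} {element p} record
  { injective = element-injective p ; preserves = λ _ _ → refl }

restrict-≤ᵢ : ∀ {H G f} p → IsEmbedding H G f → (∀ u → f u ∈ p) → H ≤ᵢ (G [ p ])
restrict-≤ᵢ {H} {G} {f} p e f∈p = embedding⇒≤ᵢ {H} {G [ p ]} {proj₁ ∘ f′} record
  { injective = λ {u} {v} eq → injective e
      (trans (sym (proj₂ (f′ u))) (trans (cong (element p) eq) (proj₂ (f′ v))))
  ; preserves = λ u v → trans (preserves e u v)
      (sym (cong₂ (adj G) (proj₂ (f′ u)) (proj₂ (f′ v))))
  }
  where
  f′ : ∀ u → ∃ λ i → element p i ≡ f u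
  f′ u = index p (f∈p u)

------------------------------------------------------------------------
-- Components

reachable? : ∀ G → Decidable (Reachable G)
reachable? G = star? λ u v → adj G u v Bool.≟ true

adjacent-sym : ∀ G {u v} → Adjacent G u v → Adjacent G v u
adjacent-sym G {u} {v} = trans (adj-sym G v u)

-- The vertices that can be reached from v.
component : ∀ G → Vertex G → Subset (order G)
component G v = Vec.tabulate λ w → does (reachable? G v w)

component-isComponent : ∀ G v → IsComponent G (component G v)
component-isComponent G v = v , λ w → mk⇔ (to w) (from w)
  where
  to : ∀ w → w ∈ component G v → Reachable G v w
  to w w∈C = does-true (reachable? G v w)
    (trans (sym (lookup∘tabulate (λ w → does (reachable? G v w)) w)) ([]=⇒lookup w∈C))
  from : ∀ w → Reachable G v w → w ∈ component G v
  from w r = lookup⇒[]= w _ (trans (lookup∘tabulate _ w) (dec-true (reachable? G v w) r))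

component-connected : ∀ G C → IsComponent G C → Connected (G [ C ])
component-connected G C (v , C-spec) = proj₁ v′ , connect
  where
  module C-spec w = Equivalence (C-spec w)

  v′ : ∃ λ i → element C i ≡ v
  v′ = index C (C-spec.from v ε)

  -- A walk of G that starts in C stays in C.
  inside-C : ∀ a {x y} → element C a ≡ x → Reachable G x y →
             ∃ λ b → element C b ≡ y × Reachable (G [ C ]) a b
  inside-C a eq ε = a , eq , ε
  inside-C a refl (_◅_ {j = z} s r) =
    let a′ , eq = index C (C-spec.from z (C-spec.to _ (element-∈ C a) ◅◅ s ◅ ε))
        b , eq′ , r′ = inside-C a′ eq r
    in b , eq′ , subst (Adjacent G (element C a)) (sym eq) s ◅ r′

  connect : ∀ a b → Reachable (G [ C ]) a b
  connect a b =
    let b′ , eq , r = inside-C a refl (Star.reverse (adjacent-sym G) (C-spec.to _ (element-∈ C a))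
                                        ◅◅ C-spec.to _ (element-∈ C b))
    in subst (Reachable (G [ C ]) a) (element-injective C eq) r

module _ {ℓ} (Π : GraphClass ℓ) {𝓕 : List Graph} (hereditary : Hereditary Π)
         (forbidden : IsForbiddenFamily Π 𝓕) where

  class⇒free : ∀ G → Π G → All (λ H → ¬ (H ≤ᵢ G)) 𝓕
  class⇒free G πG = Equivalence.to (forbidden G) λ C _ → hereditary ([]-≤ᵢ G C) πG

  -- The forbidden family speaks of the components of G; the only one is G
  -- itself, as the subgraph induced by all its vertices.
  connected-free⇒class : ∀ G → Connected G → All (λ H → ¬ (H ≤ᵢ G)) 𝓕 → Π G
  connected-free⇒class G (v , connected) free =
    hereditary (restrict-≤ᵢ {G} {G} {id} ⊤ (record { injective = id ; preserves = λ _ _ → refl }) λ _ → ∈⊤)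
      (Equivalence.from (forbidden G) free ⊤ (v , λ w → mk⇔ (λ _ → connected v w) (λ _ → ∈⊤)))

------------------------------------------------------------------------
-- Patterns

-- The pattern of a c-tuple of vertices records for each pair of positions
-- whether the two entries are equal and whether they are adjacent.
Pattern : ℕ → Set
Pattern c = Fin c → Fin c → Bool × Bool

test : ∀ G → Pattern (order G)
test G u v = (toℕ u ≡ᵇ toℕ v) , adj G u v

-- M is the pattern of the tuple x.  It is stated pointwise, since patterns
-- are functions.
Represents : ∀ G → (Fin c → Vertex G) → Pattern c → Set
Represents G x M = ∀ i j → M i j ≡ test G (x i) (x j)

represents-[] : ∀ G p {x : Fin c → Vertex (G [ p ])} {M} →
                Represents G (element p ∘ x) M → Represents (G [ p ]) x M
represents-[] G p {x} rep i j = trans (rep i j) (cong (_, adj (G [ p ]) (x i) (x j)) (sym (element-≡ᵇ p (x i) (x j))))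

-- H is isomorphic to an induced subgraph of the graph that the tuple
-- induces; the witness is a list of positions, so that the property is
-- decided by a finite search.
Occurs : Graph → Pattern c → Set
Occurs {c} H M = ∃ λ (g : Vec (Fin c) (order H)) → ∀ u v →
  (proj₁ (M (lookup g u) (lookup g v)) ≡ true → u ≡ v) ×
  adj H u v ≡ proj₂ (M (lookup g u) (lookup g v))

-- The entries at the two positions are equal or adjacent.
Linked : Pattern c → Fin c → Fin c → Set
Linked M i j = proj₁ (M i j) ∨ proj₂ (M i j) ≡ true

occurs? : ∀ H (M : Pattern c) → Dec (Occurs H M)
occurs? H M = anyVec? _ λ g → all? λ u → all? λ v →
  (_ Bool.≟ true →-dec u ≟ v) ×-dec (_ Bool.≟ _)

module _ {G} {x : Fin c → Vertex G} {M : Pattern c} (rep : Represents G x M) where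

  occurs⇒embedding : ∀ {H} → Occurs H M → ∃ λ g → IsEmbedding H G (x ∘ g)
  occurs⇒embedding (g , spec) = lookup g , record
    { injective = λ {u} {v} eq → proj₁ (spec u v) (trans (cong proj₁ (rep _ _)) (≡⇒≡ᵇ eq))
    ; preserves = λ u v → trans (proj₂ (spec u v)) (cong proj₂ (rep _ _))
    }

  embedding⇒occurs : ∀ {H f} → IsEmbedding H G f → (∀ u → ∃ λ i → x i ≡ f u) → Occurs H M
  embedding⇒occurs {H} {f} e onto = Vec.tabulate (proj₁ ∘ onto) , spec
    where
    g = lookup (Vec.tabulate (proj₁ ∘ onto))
    xg : ∀ u → x (g u) ≡ f u
    xg u = trans (cong x (lookup∘tabulate (proj₁ ∘ onto) u)) (proj₂ (onto u))
    spec : ∀ u v → (proj₁ (M (g u) (g v)) ≡ true → u ≡ v) × adj H u v ≡ proj₂ (M (g u) (g v))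
    spec u v =
      (λ eq → injective e (trans (sym (xg u)) (trans (≡ᵇ⇒≡ (trans (sym (cong proj₁ (rep _ _))) eq)) (xg v)))) ,
      trans (preserves e u v) (trans (sym (cong₂ (adj G) (xg u) (xg v))) (sym (cong proj₂ (rep _ _))))

  linked⇒reachable : ∀ {i j} → Star (Linked M) i j → Reachable G (x i) (x j)
  linked⇒reachable ε = ε
  linked⇒reachable (_◅_ {i} {j} {k} l ls) with proj₁ (M i j) in eq | proj₂ (M i j) in eq′
  ... | true  | _    = subst (λ y → Reachable G y (x k))
                         (sym (≡ᵇ⇒≡ {i = x i} {x j} (trans (sym (cong proj₁ (rep i j))) eq))) (linked⇒reachable ls)
  ... | false | true = trans (sym (cong proj₂ (rep i j))) eq′ ◅ linked⇒reachable ls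

-- A graph is the pattern of the tuple of all its vertices.
≤ᵢ? : ∀ H G → Dec (H ≤ᵢ G)
≤ᵢ? H G = map′
  (λ o → embedding⇒≤ᵢ {H} {G} (proj₂ (occurs⇒embedding {G = G} {id} {test G} (λ _ _ → refl) o)))
  (λ i → embedding⇒occurs {G = G} {id} {test G} (λ _ _ → refl) (≤ᵢ⇒embedding {H} {G} i) λ u → _ , refl)
  (occurs? H (test G))

module _ (𝓕₁ 𝓕₂ : List Graph) where

  -- The tuple induces a connected graph that contains members of both
  -- families.
  Bad : Pattern c → Set
  Bad M = Any (λ H → Occurs H M) 𝓕₁ × Any (λ H → Occurs H M) 𝓕₂ × (∀ i j → Star (Linked M) i j)

  -- The tuple x of vertices of G has a bad pattern.
  BadTuple : ∀ G → (Fin c → Vertex G) → Set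
  BadTuple G x = ∀ M → Represents G x M → Bad M

  bad? : (M : Pattern c) → Dec (Bad M)
  bad? M = Any.any? (λ H → occurs? H M) 𝓕₁ ×-dec Any.any? (λ H → occurs? H M) 𝓕₂ ×-dec
    all? λ i → all? λ j → star? (λ i j → _ Bool.≟ true) i j

------------------------------------------------------------------------
-- Walks and geodesics

module _ (G : Graph) (v : Vertex G) where

  -- Walk k x: a walk with k edges from v to x.
  Walk : ℕ → Vertex G → Set
  Walk zero    x = v ≡ x
  Walk (suc k) x = ∃ λ y → Walk k y × Adjacent G y x

  walk? : ∀ k x → Dec (Walk k x)
  walk? zero    x = v ≟ x
  walk? (suc k) x = any? λ y → walk? k y ×-dec (adj G y x Bool.≟ true)

  extendWalk : ∀ {k x y} → Walk k x → Reachable G x y → ∃ λ l → Walk l y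
  extendWalk w ε       = _ , w
  extendWalk w (a ◅ r) = extendWalk (_ , w , a) r

  -- A walk from v to x of minimum length.
  Geodesic : ℕ → Vertex G → Set
  Geodesic k x = Walk k x × (∀ {i} → i < k → ¬ Walk i x)

  geodesic-init : ∀ {k x} (g : Geodesic (suc k) x) → Geodesic k (proj₁ (proj₁ g))
  geodesic-init ((y , w , a) , shortest) = w , λ i<k w′ → shortest (s≤s i<k) (y , w′ , a)

  geodesic-prefix : ∀ {k l x} → k ≤ l → Geodesic l x → ∃ (Geodesic k)
  geodesic-prefix {k} {l} k≤l g with ℕ.m≤n⇒m<n∨m≡n k≤l
  ... | inj₂ refl       = _ , g
  ... | inj₁ (s≤s k≤l′) = geodesic-prefix k≤l′ (geodesic-init g)

  -- The vertices of a walk, from its end back to v.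
  trail : ∀ {k x} → Walk k x → Fin (suc k) → Vertex G
  trail {x = x}     w           zero    = x
  trail {k = suc k} (y , w , a) (suc j) = trail w j

  trail-last : ∀ {k x} (w : Walk k x) → trail w (fromℕ k) ≡ v
  trail-last {zero}  refl        = refl
  trail-last {suc k} (y , w , a) = trail-last w

  trail-walk : ∀ {k x} (w : Walk k x) j → ∃ λ d → d + toℕ j ≡ k × Walk d (trail w j)
  trail-walk {k}     w           zero    = k , ℕ.+-identityʳ k , w
  trail-walk {suc k} (y , w , a) (suc j) =
    let d , eq , w′ = trail-walk w j in d , trans (ℕ.+-suc d (toℕ j)) (cong suc eq) , w′

  -- The vertices of a geodesic induce a path.
  trail-embedding : ∀ {k x} (g : Geodesic k x) → IsEmbedding (path (suc k)) G (trail (proj₁ g))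
  trail-embedding g = record { injective = inj g ; preserves = pres g }
    where
    end-fresh : ∀ {k x} (g : Geodesic (suc k) x) j → x ≢ trail (proj₁ g) (suc j)
    end-fresh (w , shortest) j eq with trail-walk w (suc j)
    ... | d , d+1+j≡1+k , w′ =
      shortest (ℕ.m+n≤o⇒m≤o (suc d) (ℕ.≤-reflexive (trans (sym (ℕ.+-suc d _)) d+1+j≡1+k)))
               (subst (Walk d) (sym eq) w′)

    no-shortcut : ∀ {k x} (g : Geodesic (suc k) x) j → ¬ Adjacent G (trail (proj₁ g) (suc (suc j))) x
    no-shortcut {suc k} ((_ , (_ , w , _) , _) , shortest) j a with trail-walk w j
    ... | d , d+j≡k , w′ =
      shortest (s≤s (s≤s (ℕ.m+n≤o⇒m≤o d (ℕ.≤-reflexive d+j≡k)))) (_ , w′ , a)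

    inj : ∀ {k x} (g : Geodesic k x) {i j} → trail (proj₁ g) i ≡ trail (proj₁ g) j → i ≡ j
    inj g {zero} {zero} eq = refl
    inj {suc k} g {zero}  {suc j} eq = contradiction eq (end-fresh g j)
    inj {suc k} g {suc i} {zero}  eq = contradiction (sym eq) (end-fresh g i)
    inj {suc k} g {suc i} {suc j} eq = cong suc (inj (geodesic-init g) eq)

    pres-zero : ∀ {k x} (g : Geodesic k x) j → adj (path (suc k)) zero j ≡ adj G x (trail (proj₁ g) j)
    pres-zero         g zero          = sym (adj-irrefl G _)
    pres-zero {suc k} g (suc zero)    = sym (adjacent-sym G (proj₂ (proj₂ (proj₁ g))))
    pres-zero {suc (suc k)} g (suc (suc j)) =
      sym (Bool.¬-not λ a → no-shortcut g j (adjacent-sym G a))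

    pres : ∀ {k x} (g : Geodesic k x) i j →
           adj (path (suc k)) i j ≡ adj G (trail (proj₁ g) i) (trail (proj₁ g) j)
    pres         g zero    j       = pres-zero g j
    pres {suc k} g (suc i) zero    =
      trans (adj-sym (path (suc (suc k))) (suc i) zero) (trans (pres-zero g (suc i)) (adj-sym G _ _))
    pres {suc k} g (suc i) (suc j) = pres (geodesic-init g) i j

  -- The vertices of a walk except its end.
  initVertices : ∀ {k x} → Walk k x → List (Vertex G)
  initVertices {zero}  w           = []
  initVertices {suc k} (y , w , a) = y ∷ initVertices w

  length-initVertices : ∀ {k x} (w : Walk k x) → length (initVertices w) ≡ k
  length-initVertices {zero}  w           = refl
  length-initVertices {suc k} (y , w , a) = cong suc (length-initVertices w)

------------------------------------------------------------------------
-- Finding a bad tuple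

-- xs as a vector of length c, filled up with copies of r.
pad : ∀ {A : Set} c (xs : List A) → length xs ≤ c → A → Vec A c
pad c       []       _         r = Vec.replicate c r
pad (suc c) (x ∷ xs) (s≤s len) r = x ∷ pad c xs len r

∈⇒pad : ∀ {A : Set} {c} {xs : List A} (len : length xs ≤ c) {r y} → y ∈ˡ xs → ∃ λ i → lookup (pad c xs len r) i ≡ y
∈⇒pad (s≤s len) (here refl)  = zero , refl
∈⇒pad (s≤s len) (there y∈xs) = let i , eq = ∈⇒pad len y∈xs in suc i , eq

pad⇒∈ : ∀ {A : Set} {c} {xs : List A} (len : length xs ≤ c) {r} i → let y = lookup (pad c xs len r) i in y ≡ r ⊎ y ∈ˡ xs
pad⇒∈ {c = c} {[]} len {r} i     = inj₁ (lookup-replicate i r)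
pad⇒∈ {xs = x ∷ xs} (s≤s len) zero    = inj₂ (here refl)
pad⇒∈ {xs = x ∷ xs} (s≤s len) (suc i) = Sum.map₂ there (pad⇒∈ len i)

-- All the elements of Fin n except i.
others : Fin n → List (Fin n)
others {suc n} i = List.tabulate (punchIn i)

length-others : (i : Fin n) → length (others i) ≡ pred n
length-others {suc n} i = length-tabulate (punchIn i)

∈-others : {i j : Fin n} → i ≢ j → j ∈ˡ others i
∈-others {suc n} i≢j = subst (_∈ˡ others _) (punchIn-punchOut i≢j) (∈-tabulate⁺ (punchOut i≢j))

module _ {𝓕₁ 𝓕₂ : List Graph} {G : Graph} where

  -- Adjacency in the subgraph induced by xs.
  AdjacentIn : List (Vertex G) → Vertex G → Vertex G → Set
  AdjacentIn xs y z = y ∈ˡ xs × z ∈ˡ xs × Adjacent G y z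

  -- At most c vertices, given as a list, can be turned into a c-tuple by
  -- repeating one of them.  Connectivity is stated as reachability of r.
  list⇒bad : ∀ xs r → length xs ≤ c → r ∈ˡ xs → (∀ {y} → y ∈ˡ xs → Star (AdjacentIn xs) y r) →
    ∀ {H₁ f₁ H₂ f₂} → H₁ ∈ˡ 𝓕₁ → H₂ ∈ˡ 𝓕₂ → IsEmbedding H₁ G f₁ → IsEmbedding H₂ G f₂ →
    (∀ u → f₁ u ∈ˡ xs) → (∀ u → f₂ u ∈ˡ xs) →
    ∃ λ (x : Fin c → Vertex G) → BadTuple 𝓕₁ 𝓕₂ G x
  list⇒bad {c} xs r len r∈xs toRoot H₁∈𝓕₁ H₂∈𝓕₂ e₁ e₂ f₁∈xs f₂∈xs = x , λ M rep →
      lose H₁∈𝓕₁ (embedding⇒occurs rep e₁ λ u → ∈⇒pad len (f₁∈xs u)) ,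
      lose H₂∈𝓕₂ (embedding⇒occurs rep e₂ λ u → ∈⇒pad len (f₂∈xs u)) ,
      λ i j → connect {M} rep i j
        (toRoot (x∈xs i) ◅◅ Star.reverse (λ { (p , q , a) → q , p , adjacent-sym G a }) (toRoot (x∈xs j))) refl
    where
    x : Fin c → Vertex G
    x = lookup (pad c xs len r)

    x∈xs : ∀ i → x i ∈ˡ xs
    x∈xs i with pad⇒∈ len {r} i
    ... | inj₁ eq = subst (_∈ˡ xs) (sym eq) r∈xs
    ... | inj₂ p  = p

    connect : ∀ {M} → Represents G x M → ∀ i j {z} → Star (AdjacentIn xs) (x i) z → x j ≡ z → Star (Linked M) i j
    connect {M} rep i j ε eq =
      cong (_∨ proj₂ (M i j)) (trans (cong proj₁ (rep i j)) (≡⇒≡ᵇ (sym eq))) ◅ ε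
    connect {M} rep i j ((_ , q , a) ◅ s) eq with ∈⇒pad len {r} q
    ... | k , refl =
      trans (cong (proj₁ (M i k) ∨_) (trans (cong proj₂ (rep i k)) a)) (Bool.∨-zeroʳ _) ◅ connect {M} rep k j s eq

  -- The union of a copy of H₁, a copy of H₂ and a walk between them.  Of the
  -- walk it suffices to add the vertices before the last one, which is in
  -- the copy of H₁; of H₂ it suffices to add the vertices other than the
  -- first one of the walk.
  walk⇒bad : ∀ {H₁ f₁ H₂ f₂ l} → H₁ ∈ˡ 𝓕₁ → H₂ ∈ˡ 𝓕₂ → IsEmbedding H₁ G f₁ → IsEmbedding H₂ G f₂ →
    Connected H₁ → (H₂-connected : Connected H₂) → ∀ u → Walk G (f₂ (proj₁ H₂-connected)) l (f₁ u) →
    order H₁ + (l + pred (order H₂)) ≤ c →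
    ∃ λ (x : Fin c → Vertex G) → BadTuple 𝓕₁ 𝓕₂ G x
  walk⇒bad {c} {H₁} {f₁} {H₂} {f₂} {l} H₁∈𝓕₁ H₂∈𝓕₂ e₁ e₂ (_ , conn₁) (v , conn₂) u w small =
    list⇒bad xs (f₁ u) (subst (_≤ c) (sym length-xs) small) (f₁∈xs u) toRoot H₁∈𝓕₁ H₂∈𝓕₂ e₁ e₂ f₁∈xs f₂∈xs
    where
    ys = List.tabulate f₁
    zs = initVertices G (f₂ v) w
    us = List.map f₂ (others v)
    xs = ys ++ zs ++ us

    length-xs : length xs ≡ order H₁ + (l + pred (order H₂))
    length-xs = trans (length-++ ys) (cong₂ _+_ (length-tabulate f₁)
      (trans (length-++ zs) (cong₂ _+_ (length-initVertices G (f₂ v) w)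
        (trans (length-map f₂ (others v)) (length-others v)))))

    f₁∈xs : ∀ u → f₁ u ∈ˡ xs
    f₁∈xs u = ∈-++⁺ˡ (∈-tabulate⁺ u)

    zs⊆xs : ∀ {y} → y ∈ˡ zs → y ∈ˡ xs
    zs⊆xs = ∈-++⁺ʳ ys ∘ ∈-++⁺ˡ

    -- Every vertex of the walk is joined to its end.
    walk-toRoot : ∀ {l x} (w : Walk G (f₂ v) l x) → (∀ {y} → y ∈ˡ initVertices G (f₂ v) w → y ∈ˡ xs) →
                  x ∈ˡ xs → ∀ {y} → y ≡ f₂ v ⊎ y ∈ˡ initVertices G (f₂ v) w → Star (AdjacentIn xs) y x
    walk-toRoot {zero}  refl        sub x∈xs (inj₁ refl) = ε
    walk-toRoot {suc l} (y , w , a) sub x∈xs p =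
      toLast p ◅◅ (sub (here refl) , x∈xs , a) ◅ ε
      where
      toLast : ∀ {z} → z ≡ f₂ v ⊎ z ∈ˡ y ∷ initVertices G (f₂ v) w → Star (AdjacentIn xs) z y
      toLast (inj₁ eq)          = walk-toRoot w (sub ∘ there) (sub (here refl)) (inj₁ eq)
      toLast (inj₂ (here refl)) = ε
      toLast (inj₂ (there z∈))  = walk-toRoot w (sub ∘ there) (sub (here refl)) (inj₂ z∈)

    start∈ : ∀ {l x} (w : Walk G (f₂ v) l x) → f₂ v ≡ x ⊎ f₂ v ∈ˡ initVertices G (f₂ v) w
    start∈ {zero}  eq          = inj₁ eq
    start∈ {suc l} (y , w , a) with start∈ w
    ... | inj₁ eq = inj₂ (here eq)
    ... | inj₂ p  = inj₂ (there p)

    f₂∈xs : ∀ u → f₂ u ∈ˡ xs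
    f₂∈xs u′ with v ≟ u′
    ... | no  v≢u = ∈-++⁺ʳ ys (∈-++⁺ʳ zs (∈-map⁺ f₂ (∈-others v≢u)))
    ... | yes refl with start∈ w
    ...   | inj₁ eq = subst (_∈ˡ xs) (sym eq) (f₁∈xs u)
    ...   | inj₂ p  = zs⊆xs p

    via-embedding : ∀ {H f} → IsEmbedding H G f → (∀ u → f u ∈ˡ xs) → ∀ {a b} → Reachable H a b →
                    Star (AdjacentIn xs) (f a) (f b)
    via-embedding {H} {f} e f∈xs = Star.gmap f λ {a} {b} s → f∈xs a , f∈xs b , trans (sym (preserves e a b)) s

    toRoot : ∀ {y} → y ∈ˡ xs → Star (AdjacentIn xs) y (f₁ u)
    toRoot y∈xs with ∈-++⁻ ys y∈xs
    ... | inj₁ y∈ys with ∈-tabulate⁻ y∈ys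
    ...   | u′ , refl = via-embedding e₁ f₁∈xs (conn₁ u′ u)
    toRoot y∈xs | inj₂ y∈zs++us with ∈-++⁻ zs y∈zs++us
    ... | inj₁ y∈zs = walk-toRoot w zs⊆xs (f₁∈xs u) (inj₂ y∈zs)
    ... | inj₂ y∈us with ∈-map⁻ f₂ y∈us
    ...   | u′ , _ , refl = via-embedding e₂ f₂∈xs (conn₂ u′ v) ◅◅ walk-toRoot w zs⊆xs (f₁∈xs u) (inj₁ refl)

  -- A geodesic from v to the given member of 𝓕₁ is short, or its first α
  -- vertices induce a member of 𝓕₁ that contains v itself.
  shortWalk : Connected G → All Connected 𝓕₁ → ∀ {α} → path α ∈≅ 𝓕₁ → ∀ {H f} → H ∈ˡ 𝓕₁ → IsEmbedding H G f → ∀ v →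
    ∃ λ H′ → H′ ∈ˡ 𝓕₁ × ∃ λ f′ → IsEmbedding H′ G f′ × ∃ λ u → ∃ λ l → l < α × Walk G v l (f′ u)
  shortWalk (_ , conn) conns₁ {α} path∈ {H} {f} H∈𝓕₁ e v
    with u ← proj₁ (All.lookup conns₁ H∈𝓕₁)
    with l , geo ← least (λ k → walk? G v k (f u)) (proj₂ (extendWalk G v {zero} refl (conn v (f u))))
    with l ℕ.<? α
  ... | yes l<α = H , H∈𝓕₁ , f , e , u , l , l<α , proj₁ geo
  ... | no  l≮α
    with H′ , H′∈𝓕₁ , iso , pres ← find path∈
    with α
  ...   | zero  with () ← Inverse.from iso (proj₁ (All.lookup conns₁ H′∈𝓕₁))
  ...   | suc k
    with x , geo′ ← geodesic-prefix G v (ℕ.<⇒≤ (ℕ.≮⇒≥ l≮α)) geo =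
      H′ , H′∈𝓕₁ , t ∘ from , embedding , to (fromℕ k) , zero , ℕ.0<1+n ,
      sym (trans (cong t (strictlyInverseʳ (fromℕ k))) (trail-last G v (proj₁ geo′)))
    where
    open Inverse iso using (to; from; strictlyInverseʳ; strictlyInverseˡ)
    t : Fin (suc k) → Vertex G
    t = trail G v (proj₁ geo′)
    e′ : IsEmbedding (path (suc k)) G t
    e′ = trail-embedding G v geo′
    embedding : IsEmbedding H′ G (t ∘ from)
    embedding = record
      { injective = λ {a} {b} eq → trans (sym (strictlyInverseˡ a))
          (trans (cong to (injective e′ eq)) (strictlyInverseˡ b))
      ; preserves = λ a b → trans
          (sym (trans (pres (from a) (from b)) (cong₂ (adj H′) (strictlyInverseˡ a) (strictlyInverseˡ b))))
          (preserves e′ (from a) (from b))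
      }

  connected⇒bad : Connected G → All Connected 𝓕₁ → All Connected 𝓕₂ → ∀ {α} → path α ∈≅ 𝓕₁ →
    ∀ {d₁ d₂} → All (λ H → order H ≤ d₁) 𝓕₁ → All (λ H → order H ≤ d₂) 𝓕₂ → d₁ + d₂ + α ∸ 2 ≤ c →
    Any (_≤ᵢ G) 𝓕₁ → Any (_≤ᵢ G) 𝓕₂ →
    ∃ λ (x : Fin c → Vertex G) → BadTuple 𝓕₁ 𝓕₂ G x
  connected⇒bad G-conn conns₁ conns₂ {α} path∈ {d₁} {d₂} ≤d₁ ≤d₂ small any₁ any₂
    with H₁ , H₁∈𝓕₁ , i₁ ← find any₁
    with H₂ , H₂∈𝓕₂ , i₂ ← find any₂
    with H₂-conn@(v , _) ← All.lookup conns₂ H₂∈𝓕₂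
    with H , H∈𝓕₁ , f , e , u , l , l<α , w
      ← shortWalk G-conn conns₁ path∈ H₁∈𝓕₁ (≤ᵢ⇒embedding i₁) (Injection.to (proj₁ i₂) v)
    = walk⇒bad H∈𝓕₁ H₂∈𝓕₂ e (≤ᵢ⇒embedding i₂) (All.lookup conns₁ H∈𝓕₁) H₂-conn u w
        (ℕ.≤-trans (budget (All.lookup ≤d₁ H∈𝓕₁) l<α (All.lookup ≤d₂ H₂∈𝓕₂) v) small)
    where
    -- The 2 is saved by the strict inequality for l and by the vertex
    -- that H₂ shares with the walk.
    budget : ∀ {a l b} → a ≤ d₁ → l < α → b ≤ d₂ → Fin b → a + (l + pred b) ≤ d₁ + d₂ + α ∸ 2
    budget {a} {l} {suc b} a≤d₁ l<α b<d₂ _ = ℕ.m+n≤o⇒m≤o∸n _ (begin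
      a + (l + b) + 2       ≡⟨ solve 3 (λ a l b → a :+ (l :+ b) :+ con 2 := a :+ (con 1 :+ b) :+ (con 1 :+ l)) refl a l b ⟩
      a + suc b + suc l     ≤⟨ ℕ.+-mono-≤ (ℕ.+-mono-≤ a≤d₁ b<d₂) l<α ⟩
      d₁ + d₂ + α           ∎)
      where open ℕ.≤-Reasoning
            open +-*-Solver

------------------------------------------------------------------------
-- Deletion sets are hitting sets of the bad tuples

module _ {ℓ₁ ℓ₂} (Π₁ : GraphClass ℓ₁) (Π₂ : GraphClass ℓ₂) {𝓕₁ 𝓕₂ : List Graph}
  (hereditary₁ : Hereditary Π₁) (hereditary₂ : Hereditary Π₂)
  (forbidden₁ : IsForbiddenFamily Π₁ 𝓕₁) (forbidden₂ : IsForbiddenFamily Π₂ 𝓕₂) where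

  -- The position i₀ is needed because an empty tuple lies in no component.
  noBad : ∀ {G} → EachComponent (λ H → Π₁ H ⊎ Π₂ H) G →
          ∀ {x : Fin c → Vertex G} {M} → Fin c → Represents G x M → ¬ Bad 𝓕₁ 𝓕₂ M
  noBad {c} {G} each {x} {M} i₀ rep (any₁ , any₂ , conn) =
    Sum.[ (λ π₁ → All¬⇒¬Any (class⇒free Π₁ hereditary₁ forbidden₁ (G [ C ]) π₁) (Any.map (λ {H} → occurs⇒≤ᵢ {H}) any₁))
        , (λ π₂ → All¬⇒¬Any (class⇒free Π₂ hereditary₂ forbidden₂ (G [ C ]) π₂) (Any.map (λ {H} → occurs⇒≤ᵢ {H}) any₂))
        ] (each C (component-isComponent G (x i₀)))
    where
    C : Subset (order G)
    C = component G (x i₀)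

    x∈C : ∀ i → x i ∈ C
    x∈C i = Equivalence.from (proj₂ (component-isComponent G (x i₀)) (x i)) (linked⇒reachable {G = G} {x} rep (conn i₀ i))

    occurs⇒≤ᵢ : ∀ {H} → Occurs H M → H ≤ᵢ (G [ C ])
    occurs⇒≤ᵢ {H} o = let g , e = occurs⇒embedding {G = G} {x} rep o in restrict-≤ᵢ {H} {G} {x ∘ g} C e (x∈C ∘ g)

  each⇒hit : ∀ G S → EachComponent (λ H → Π₁ H ⊎ Π₂ H) (G - S) →
             ∀ {x : Fin c → Vertex G} {M} → Fin c → Represents G x M → Bad 𝓕₁ 𝓕₂ M → ∃ λ i → x i ∈ S
  each⇒hit {c} G S each {x} {M} i₀ rep bad with any? (λ i → x i ∈? S)
  ... | yes hit = hit
  ... | no miss = contradiction bad (noBad {G = G - S} each {x = proj₁ ∘ x′} i₀ rep′)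
    where
    x′ : ∀ i → ∃ λ j → element (∁ S) j ≡ x i
    x′ i = index (∁ S) (x∉p⇒x∈∁p λ xi∈S → miss (i , xi∈S))

    rep′ : Represents (G - S) (proj₁ ∘ x′) M
    rep′ = represents-[] G (∁ S) λ i j →
      trans (rep i j) (sym (cong₂ (test G) (proj₂ (x′ i)) (proj₂ (x′ j))))

  module _ (conns₁ : All Connected 𝓕₁) (conns₂ : All Connected 𝓕₂)
    {α} (path∈ : path α ∈≅ 𝓕₁) {d₁ d₂} (≤d₁ : All (λ H → order H ≤ d₁) 𝓕₁) (≤d₂ : All (λ H → order H ≤ d₂) 𝓕₂)
    (small : d₁ + d₂ + α ∸ 2 ≤ c) where

    noBad⇒each : ∀ G → (∀ (x : Fin c → Vertex G) → ¬ BadTuple 𝓕₁ 𝓕₂ G x) →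
      EachComponent (λ H → Π₁ H ⊎ Π₂ H) G
    noBad⇒each G none C C-comp = decide
      (Any.any? (λ H → ≤ᵢ? H (G [ C ])) 𝓕₁) (Any.any? (λ H → ≤ᵢ? H (G [ C ])) 𝓕₂)
      where
      K-conn : Connected (G [ C ])
      K-conn = component-connected G C C-comp

      decide : Dec (Any (_≤ᵢ (G [ C ])) 𝓕₁) → Dec (Any (_≤ᵢ (G [ C ])) 𝓕₂) → Π₁ (G [ C ]) ⊎ Π₂ (G [ C ])
      decide (no ¬any₁) _          = inj₁ (connected-free⇒class Π₁ hereditary₁ forbidden₁ _ K-conn (¬Any⇒All¬ 𝓕₁ ¬any₁))
      decide (yes _)    (no ¬any₂) = inj₂ (connected-free⇒class Π₂ hereditary₂ forbidden₂ _ K-conn (¬Any⇒All¬ 𝓕₂ ¬any₂))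
      decide (yes any₁) (yes any₂) =
        let x , bad = connected⇒bad {𝓕₁} {𝓕₂} {G [ C ]} K-conn conns₁ conns₂ path∈ ≤d₁ ≤d₂ small any₁ any₂
        in ⊥-elim (none (element C ∘ x) λ M rep → bad M (represents-[] G C {x} rep))

    hit⇒each : ∀ G S → (∀ (x : Fin c → Vertex G) → BadTuple 𝓕₁ 𝓕₂ G x → ∃ λ i → x i ∈ S) →
               EachComponent (λ H → Π₁ H ⊎ Π₂ H) (G - S)
    hit⇒each G S hit = noBad⇒each (G - S) λ x bad →
      let i , xi∈S = hit (element (∁ S) ∘ x) λ M rep → bad M (represents-[] G (∁ S) {x} rep)
      in x∈∁p⇒x∉p (element-∈ (∁ S) (x i)) xi∈S

------------------------------------------------------------------------
-- Upper bounds on running times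

-- The constants are abstract to keep them out of normal forms.
abstract
  -- At least the number of steps that any function below performs outside
  -- its calls, for one evaluation of its body.
  overhead : ℕ
  overhead = 100

  ≤overhead : ∀ {j} → True (j ℕ.≤? 100) → j ≤ overhead
  ≤overhead = toWitness

  -- The cost of a loop of m iterations whose calls cost at most A each.
  -- The extra iteration is the one that finds the loop finished.
  loop : ℕ → ℕ → ℕ
  loop A m = suc m * (overhead + A)

  loop-unfold : ∀ A m → loop A m ≡ suc m * (overhead + A)
  loop-unfold A m = refl

  loop-monoʳ : ∀ {A m m′} → m ≤ m′ → loop A m ≤ loop A m′
  loop-monoʳ {A} m≤m′ = ℕ.*-monoˡ-≤ (overhead + A) (s≤s m≤m′)

module Bounds {s} (bodies : Vec (Expr s 1) s) where

  -- e evaluates to v in at most j + sum L units: j counts the steps of the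
  -- expression itself, and L lists the bounds on its calls.  For a concrete
  -- expression j is a numeral and L a list of explicit length, so that both
  -- are computed by unification.
  record Within (ρ : Vec Tree n) (e : Expr s n) (v : Tree) (j : ℕ) (L : List ℕ) : Set where
    constructor within
    field
      {time} : ℕ
      eval   : Eval bodies ρ e v time
      bound  : time ≤ j + sum L

  join : ∀ {t₁ t₂ j₁ j₂} L₁ {L₂} → t₁ ≤ j₁ + sum L₁ → t₂ ≤ j₂ + sum L₂ →
         1 + t₁ + t₂ ≤ 1 + j₁ + j₂ + sum (L₁ ++ L₂)
  join {t₁} {t₂} {j₁} {j₂} L₁ {L₂} p q = s≤s (begin
    t₁ + t₂                             ≤⟨ ℕ.+-mono-≤ p q ⟩
    j₁ + sum L₁ + (j₂ + sum L₂)         ≡⟨ solve 4 (λ a b c d → a :+ b :+ (c :+ d) := a :+ c :+ (b :+ d)) refl j₁ (sum L₁) j₂ (sum L₂) ⟩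
    j₁ + j₂ + (sum L₁ + sum L₂)         ≡⟨ cong (j₁ + j₂ +_) (sum-++ L₁ L₂) ⟨
    j₁ + j₂ + sum (L₁ ++ L₂)       ∎)
    where open ℕ.≤-Reasoning
          open +-*-Solver

  private variable
    ρ : Vec Tree n
    e e₁ e₂ : Expr s n
    v v₁ v₂ l r a : Tree
    j j₁ j₂ τ τ′ : ℕ
    L L₁ L₂ : List ℕ

  varW : ∀ i → Within ρ (var i) (lookup ρ i) 1 []
  varW i = within (var i) ℕ.≤-refl

  nilW : Within ρ nil nil 1 []
  nilW = within nil ℕ.≤-refl

  consW : Within ρ e₁ v₁ j₁ L₁ → Within ρ e₂ v₂ j₂ L₂ →
          Within ρ (cons e₁ e₂) (v₁ ∙ v₂) (1 + j₁ + j₂) (L₁ ++ L₂)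
  consW {L₁ = L₁} (within p b) (within q c) = within (cons p q) (join L₁ b c)

  nilBranch : ∀ {e₂ : Expr s (2 + n)} → Within ρ e nil j L → Within ρ e₁ v j₁ L₁ →
              Within ρ (match e e₁ e₂) v (1 + j + j₁) (L ++ L₁)
  nilBranch {L = L} (within p b) (within q c) = within (match-nil p q) (join L b c)

  consBranch : Within ρ e (l ∙ r) j L → Within (l ∷ r ∷ ρ) e₂ v j₂ L₂ →
               Within ρ (match e e₁ e₂) v (1 + j + j₂) (L ++ L₂)
  consBranch {L = L} (within p b) (within q c) = within (match-cons p q) (join L b c)

  letW : Within ρ e₁ v₁ j₁ L₁ → Within (v₁ ∷ ρ) e₂ v₂ j₂ L₂ →
         Within ρ (letin e₁ e₂) v₂ (1 + j₁ + j₂) (L₁ ++ L₂)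
  letW {L₁ = L₁} (within p b) (within q c) = within (letin p q) (join L₁ b c)

  -- Function f maps a to v within time τ.
  Computes : Fin s → Tree → Tree → ℕ → Set
  Computes f a v τ = Within (a ∷ []) (lookup bodies f) v 0 (τ ∷ [])

  callW : ∀ {f} → Within ρ e a j L → Computes f a v τ →
          Within ρ (call f e) v (1 + j + 0) (L ++ τ ∷ [])
  callW {L = L} (within p b) (within q c) = within (call p q) (join L b c)

  -- Once the bound is final, the whole cost is treated as that of one call.
  weaken : Within ρ e v j L → j + sum L ≤ τ′ → Within ρ e v 0 (τ′ ∷ [])
  weaken (within p b) le = within p (ℕ.≤-trans b (ℕ.≤-trans le (ℕ.≤-reflexive (sym (ℕ.+-identityʳ _)))))

  enlarge : Within ρ e v 0 (τ ∷ []) → τ ≤ τ′ → Within ρ e v 0 (τ′ ∷ [])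
  enlarge w le = weaken w (ℕ.≤-trans (ℕ.≤-reflexive (ℕ.+-identityʳ _)) le)

  -- A numeral up to 100 is absorbed by the overhead.
  bounded : Within ρ e v j L → {True (j ℕ.≤? 100)} → sum L ≤ τ → Within ρ e v 0 (overhead + τ ∷ [])
  bounded w {j≤} le = weaken w (ℕ.+-mono-≤ (≤overhead j≤) le)

  loopEnd : ∀ {A m} → Within ρ e v j [] → {True (j ℕ.≤? 100)} → Within ρ e v 0 (loop A m ∷ [])
  loopEnd {A = A} {m} w {j≤} = enlarge (bounded w {j≤} z≤n) (begin
    overhead + 0              ≤⟨ ℕ.+-monoʳ-≤ overhead z≤n ⟩
    overhead + A              ≤⟨ ℕ.m≤m+n _ _ ⟩
    suc m * (overhead + A)    ≡⟨ loop-unfold A m ⟨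
    loop A m                  ∎)
    where open ℕ.≤-Reasoning

  loopStep : ∀ {A m} → Within ρ e v j L → {True (j ℕ.≤? 100)} → sum L ≤ A + loop A m →
             Within ρ e v 0 (loop A (suc m) ∷ [])
  loopStep {A = A} {m} w {j≤} le = enlarge (bounded w {j≤} le) (begin
    overhead + (A + loop A m)                     ≡⟨ ℕ.+-assoc overhead A (loop A m) ⟨
    overhead + A + loop A m                       ≡⟨ cong (overhead + A +_) (loop-unfold A m) ⟩
    suc (suc m) * (overhead + A)                  ≡⟨ loop-unfold A (suc m) ⟨
    loop A (suc m)                                ∎)
    where open ℕ.≤-Reasoning

only : ∀ {R} → R + 0 ≤ R
only = ℕ.≤-reflexive (ℕ.+-identityʳ _)

firstThen : ∀ A {R} → A + (R + 0) ≤ A + R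
firstThen A = ℕ.+-monoʳ-≤ A only

thenFirst : ∀ A {R} → R + (A + 0) ≤ A + R
thenFirst A {R} = ℕ.≤-reflexive (trans (cong (R +_) (ℕ.+-identityʳ A)) (ℕ.+-comm R A))

------------------------------------------------------------------------
-- Branching

anyᵇ : ∀ {A : Set} → (A → Bool) → Vec A m → Bool
anyᵇ p []       = false
anyᵇ p (x ∷ xs) = p x ∨ anyᵇ p xs

_∈ᵇ_ : Fin n → Vec (Fin n) m → Bool
u ∈ᵇ xs = anyᵇ (λ v → toℕ u ≡ᵇ toℕ v) xs

-- The tuples that do not contain u.
drop : Fin n → List (Vec (Fin n) m) → List (Vec (Fin n) m)
drop u = filterᵇ (λ xs → not (u ∈ᵇ xs))

-- Is there a set of at most k elements that hits every tuple of a family?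
hittable : ℕ → List (Vec (Fin n) m) → Bool
hittable k       []       = true
hittable zero    (x ∷ xs) = false
hittable (suc k) (x ∷ xs) = anyᵇ (λ u → hittable k (drop u (x ∷ xs))) x

-- All j-tuples of elements of Fin n.
tuples : ∀ n j → List (Vec (Fin n) j)
tuples n zero    = [] ∷ []
tuples n (suc j) = cartesianProductWith _∷_ (List.allFin n) (tuples n j)

-- The pattern of a tuple, row by row.
bits : ∀ G → Vec (Vertex G) m → Vec (Bool × Bool) (m * m)
bits G xs = Vec.concat (Vec.map (λ u → Vec.map (test G u) xs) xs)

length-cartesianProductWith : ∀ {A B C : Set} (f : A → B → C) xs ys →
  length (cartesianProductWith f xs ys) ≡ length xs * length ys
length-cartesianProductWith f []       ys = refl
length-cartesianProductWith f (x ∷ xs) ys =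
  trans (length-++ (List.map (f x) ys)) (cong₂ _+_ (length-map (f x) ys) (length-cartesianProductWith f xs ys))

length-tuples : ∀ n j → length (tuples n j) ≡ n ^ j
length-tuples n zero    = refl
length-tuples n (suc j) =
  trans (length-cartesianProductWith _∷_ (List.allFin n) (tuples n j))
        (cong₂ _*_ (length-tabulate {n = n} id) (length-tuples n j))

------------------------------------------------------------------------
-- Encodings

encodeVec : ∀ {A : Set} → (A → Tree) → Vec A m → Tree
encodeVec enc xs = encodeList (toList (Vec.map enc xs))

encodePair : Bool × Bool → Tree
encodePair (a , b) = encodeBool a ∙ encodeBool b

-- A vertex is represented by its number, which decides equality, and its row
-- of the adjacency matrix, which decides adjacency.
encodeVertex : ∀ G → Vertex G → Tree
encodeVertex G u = encodeℕ (toℕ u) ∙ encodeList (List.tabulate (encodeBool ∘ adj G u))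

encodeTuples : ∀ G → List (Vec (Vertex G) m) → Tree
encodeTuples G xss = encodeList (List.map (encodeVec (encodeVertex G)) xss)

------------------------------------------------------------------------
-- The program

-- The functions of the program, with their arguments and results:
--   fEq      a ∙ b           are the numbers a and b equal?
--   fNth     bs ∙ i          entry i of the list bs
--   fLe      xs ∙ k          does the list xs have at most k elements?
--   fTokens  i ∙ rows        the rows, numbered from i on
--   fTest    u ∙ v           the pair of bits test G u v
--   fRow     u ∙ (vs ∙ bs)   the tests of u against all of vs, before bs
--   fBits    us ∙ vs         the tests of all of us against all of vs
--   fBad     xs              is the tuple xs bad?
--   fExtend  u ∙ (xss ∙ yss) the tuples of xss with u in front, before yss
--   fProd    us ∙ xss        all tuples of xss with one of us in front
--   fSelect  xss             the bad tuples among xss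
--   fMem     u ∙ xs          does the tuple xs contain u?
--   fDrop    u ∙ xss         the tuples of xss that do not contain u
--   fSolve   xss ∙ k         can at most k vertices hit all of xss?
--   fTry     xs ∙ (xss ∙ k)  can one vertex of xs and at most k further
--                            vertices hit all of xss?
pattern fEq = 0F
pattern fNth = 1F
pattern fLe = 2F
pattern fTokens = 3F
pattern fTest = 4F
pattern fRow = 5F
pattern fBits = 6F
pattern fBad = 7F
pattern fExtend = 8F
pattern fProd = 9F
pattern fSelect = suc 9F
pattern fMem = suc (suc 9F)
pattern fDrop = suc (suc (suc 9F))
pattern fSolve = suc (suc (suc (suc 9F)))
pattern fTry = suc (suc (suc (suc (suc 9F))))

module _ {s : ℕ} where
  v0 : Expr s (1 + n)
  v0 = var 0F
  v1 : Expr s (2 + n)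
  v1 = var 1F
  v2 : Expr s (3 + n)
  v2 = var 2F
  v3 : Expr s (4 + n)
  v3 = var 3F
  v4 : Expr s (5 + n)
  v4 = var 4F

  boolE : Bool → Expr s n
  boolE false = nil
  boolE true  = cons nil nil

  -- The decision tree of a function f of m pairs of Booleans, applied to
  -- the list of pairs in variable i.  The remaining pairs move from index 3
  -- to 5 or 7, since each branch for a true bit binds two more variables.
  decisionTree : ∀ m → (Vec (Bool × Bool) m → Bool) → Fin n → Expr s n
  decisionTree zero    f i = boolE (f [])
  decisionTree (suc m) f i =
    match (var i) nil
      (match v0 nil
        (match v0
          (match v1
            (decisionTree m (f ∘ ((false , false) ∷_)) 3F)
            (decisionTree m (f ∘ ((false , true ) ∷_)) 5F))
          (match v3
            (decisionTree m (f ∘ ((true  , false) ∷_)) 5F)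
            (decisionTree m (f ∘ ((true  , true ) ∷_)) 7F))))

-- The program for tuples of length c, where f tells the bad patterns.
module Algorithm (c : ℕ) (f : Vec (Bool × Bool) (c * c) → Bool) where

  Code : Set
  Code = Expr 15 1

  eqB nthB leB tokensB testB rowB bitsB badB extendB prodB selectB memB dropB solveB tryB : Code

  eqB = match v0 nil
    (match v0
      (match v1 (boolE true) (boolE false))
      (match v3 (boolE false) (call fEq (cons v3 v1))))

  nthB = match v0 nil
    (match v0 nil
      (match v3 v0 (call fNth (cons v3 v1))))

  leB = match v0 nil
    (match v0 (boolE true)
      (match v3 (boolE false) (call fLe (cons v3 v1))))

  tokensB = match v0 nil
    (match v1 nil
      (cons (cons v2 v0) (call fTokens (cons (cons nil v2) v1))))

  testB = match v0 nil
    (match v0 nil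
      (match v3 nil
        (cons (call fEq (cons v2 v0)) (call fNth (cons v3 v0)))))

  rowB = match v0 nil
    (match v1 nil
      (match v0 v1
        (cons (call fTest (cons v4 v0)) (call fRow (cons v4 (cons v1 v3))))))

  bitsB = match v0 nil
    (match v0 nil
      (call fRow (cons v0 (cons v3 (call fBits (cons v1 v3))))))

  badB = letin (call fBits (cons v0 v0)) (decisionTree (c * c) f 0F)

  extendB = match v0 nil
    (match v1 nil
      (match v0 v1
        (cons (cons v4 v0) (call fExtend (cons v4 (cons v1 v3))))))

  prodB = match v0 nil
    (match v0 nil
      (call fExtend (cons v0 (cons v3 (call fProd (cons v1 v3))))))

  selectB = match v0 nil
    (match (call fBad v0)
      (call fSelect v1)
      (cons v2 (call fSelect v3)))

  memB = match v0 nil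
    (match v1 nil
      (match (call fTest (cons v2 v0)) nil
        (match v0 (call fMem (cons v4 v3)) (boolE true))))

  dropB = match v0 nil
    (match v1 nil
      (match (call fMem (cons v2 v0))
        (cons v0 (call fDrop (cons v2 v1)))
        (call fDrop (cons v4 v3))))

  solveB = match v0 nil
    (match v0 (boolE true)
      (match v3 (boolE false)
        (call fTry (cons v2 (cons v4 v1)))))

  tryB = match v0 nil
    (match v1 nil
      (match v2 nil
        (match (call fSolve (cons (call fDrop (cons v0 v2)) v3))
          (call fTry (cons v1 (cons v2 v3)))
          (boolE true))))

  bodies : Vec Code 15
  bodies = eqB ∷ nthB ∷ leB ∷ tokensB ∷ testB ∷ rowB ∷ bitsB ∷ badB ∷ extendB ∷ prodB ∷
           selectB ∷ memB ∷ dropB ∷ solveB ∷ tryB ∷ []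

  -- All j-tuples of the elements of the list in variable 0.
  tuplesE : ℕ → Expr 15 (1 + n)
  tuplesE zero    = cons nil nil
  tuplesE (suc j) = call fProd (cons v0 (tuplesE j))

  program : Program
  program = record
    { size   = 15
    ; bodies = bodies
    ; main   = match v0 nil
        (match (call fLe (cons v0 v1))
          (call fSolve (cons (call fSelect (letin (call fTokens (cons nil v0)) (tuplesE c))) v1))
          (boolE true))
    }

  open Bounds bodies

  ----------------------------------------------------------------------
  -- Evaluation of the functions

  boolW : ∀ {ρ : Vec Tree n} b → Within ρ (boolE b) (encodeBool b) 3 []
  boolW false = within nil (s≤s z≤n)
  boolW true  = within (cons nil nil) ℕ.≤-refl

  eqC : ∀ a b → Computes fEq (encodeℕ a ∙ encodeℕ b) (encodeBool (a ≡ᵇ b)) (loop 0 a)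
  eqC zero    zero    = loopEnd (consBranch (varW _) (nilBranch (varW _) (nilBranch (varW _) (boolW true))))
  eqC zero    (suc b) = loopEnd (consBranch (varW _) (nilBranch (varW _) (consBranch (varW _) (boolW false))))
  eqC (suc a) zero    = loopEnd (consBranch (varW _) (consBranch (varW _) (nilBranch (varW _) (boolW false))))
  eqC (suc a) (suc b) = loopStep (consBranch (varW _) (consBranch (varW _) (consBranch (varW _)
    (callW (consW (varW _) (varW _)) (eqC a b))))) only

  nthC : (r : Fin n → Bool) (i : Fin n) →
         Computes fNth (encodeList (List.tabulate (encodeBool ∘ r)) ∙ encodeℕ (toℕ i)) (encodeBool (r i)) (loop 0 n)
  nthC r zero    = loopEnd (consBranch (varW _) (consBranch (varW _) (nilBranch (varW _) (varW _))))
  nthC r (suc i) = loopStep (consBranch (varW _) (consBranch (varW _) (consBranch (varW _)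
    (callW (consW (varW _) (varW _)) (nthC (r ∘ suc) i))))) only

  leC : (rows : List Tree) (k : ℕ) →
    Computes fLe (encodeList rows ∙ encodeℕ k) (encodeBool (length rows ≤ᵇ k)) (loop 0 (length rows))
  leC []         k       = loopEnd (consBranch (varW _) (nilBranch (varW _) (boolW true)))
  leC (r ∷ rows) zero    = loopEnd (consBranch (varW _) (consBranch (varW _) (nilBranch (varW _) (boolW false))))
  -- The Boolean comparison only reduces once rows is known to be empty or not.
  leC (r ∷ [])           (suc k) = loopStep (consBranch (varW _) (consBranch (varW _) (consBranch (varW _)
    (callW (consW (varW _) (varW _)) (leC [] k))))) only
  leC (r ∷ rows@(_ ∷ _)) (suc k) = loopStep (consBranch (varW _) (consBranch (varW _) (consBranch (varW _)
    (callW (consW (varW _) (varW _)) (leC rows k))))) only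

  -- Entry j gets the number t j, which is i + j.
  tokensC : ∀ i (r : Fin n → Tree) (t : Fin n → ℕ) → (∀ j → t j ≡ i + toℕ j) →
    Computes fTokens (encodeℕ i ∙ encodeList (List.tabulate r))
      (encodeList (List.tabulate λ j → encodeℕ (t j) ∙ r j)) (loop 0 n)
  tokensC {zero}  i r t eq = loopEnd (consBranch (varW _) (nilBranch (varW _) nilW))
  tokensC {suc n} i r t eq rewrite trans (eq zero) (ℕ.+-identityʳ i) =
    loopStep (consBranch (varW _) (consBranch (varW _) (consW (consW (varW _) (varW _))
      (callW (consW (consW nilW (varW _)) (varW _))
        (tokensC (suc i) (r ∘ suc) (t ∘ suc) λ j → trans (eq (suc j)) (ℕ.+-suc i (toℕ j))))))) only

  varAs : ∀ {ρ : Vec Tree n} {v} i → lookup ρ i ≡ v → Within ρ (var i) v 1 []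
  varAs i refl = varW i

  treeW : ∀ {ρ : Vec Tree n} m (g : Vec (Bool × Bool) m → Bool) i bs → lookup ρ i ≡ encodeVec encodePair bs →
          Within ρ (decisionTree m g i) (encodeBool (g bs)) 0 (loop 0 m ∷ [])
  treeW zero    g i []                   eq = loopEnd (boolW (g []))
  treeW (suc m) g i ((false , false) ∷ bs) eq = loopStep (consBranch (varAs i eq) (consBranch (varW _)
    (nilBranch (varW _) (nilBranch (varW _) (treeW m (g ∘ (_ ∷_)) _ bs refl))))) only
  treeW (suc m) g i ((false , true ) ∷ bs) eq = loopStep (consBranch (varAs i eq) (consBranch (varW _)
    (nilBranch (varW _) (consBranch (varW _) (treeW m (g ∘ (_ ∷_)) _ bs refl))))) only
  treeW (suc m) g i ((true  , false) ∷ bs) eq = loopStep (consBranch (varAs i eq) (consBranch (varW _)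
    (consBranch (varW _) (nilBranch (varW _) (treeW m (g ∘ (_ ∷_)) _ bs refl))))) only
  treeW (suc m) g i ((true  , true ) ∷ bs) eq = loopStep (consBranch (varAs i eq) (consBranch (varW _)
    (consBranch (varW _) (consBranch (varW _) (treeW m (g ∘ (_ ∷_)) _ bs refl))))) only

  -- The bounds below are for graphs of order n; dropT and those that use it
  -- assume families of at most n ^ c tuples.
  testT : ℕ → ℕ
  testT n = overhead + (loop 0 n + loop 0 n)

  badT : ℕ → ℕ
  badT n = overhead + (loop (loop (testT n) c) c + loop 0 (c * c))

  tuplesT : ℕ → ℕ → ℕ
  tuplesT n zero    = overhead + 0
  tuplesT n (suc j) = overhead + (tuplesT n j + loop (loop 0 (n ^ j)) n)

  dropT : ℕ → ℕ
  dropT n = loop (loop (testT n) c) (n ^ c)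

  -- The m branches at a node of the search tree, where solving each of the
  -- remaining problems costs at most S.
  tryT : ℕ → ℕ → ℕ → ℕ
  tryT n zero    S = overhead + 0
  tryT n (suc m) S = overhead + (dropT n + S + tryT n m S)

  -- Branching to depth k.
  solveT : ℕ → ℕ → ℕ
  solveT n zero    = overhead + 0
  solveT n (suc k) = overhead + tryT n c (solveT n k)

  module _ (G : Graph) where

    private
      N : ℕ
      N = order G
      encV : Vertex G → Tree
      encV = encodeVertex G

    testC : ∀ u v → Computes fTest (encV u ∙ encV v) (encodePair (test G u v)) (testT N)
    testC u v = bounded (consBranch (varW _) (consBranch (varW _) (consBranch (varW _)
        (consW (callW (consW (varW _) (varW _)) (eqC (toℕ u) (toℕ v)))
               (callW (consW (varW _) (varW _)) (nthC (adj G u) v))))))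
      (ℕ.+-mono-≤ (loop-monoʳ (ℕ.<⇒≤ (toℕ<n u))) only)

    rowC : ∀ {l} u (ys : Vec (Vertex G) m) (acc : Vec (Bool × Bool) l) →
      Computes fRow (encV u ∙ (encodeVec encV ys ∙ encodeVec encodePair acc))
        (encodeVec encodePair (Vec.map (test G u) ys Vec.++ acc)) (loop (testT N) m)
    rowC u []       acc = loopEnd (consBranch (varW _) (consBranch (varW _) (nilBranch (varW _) (varW _))))
    rowC u (y ∷ ys) acc = loopStep (consBranch (varW _) (consBranch (varW _) (consBranch (varW _)
      (consW (callW (consW (varW _) (varW _)) (testC u y))
             (callW (consW (varW _) (consW (varW _) (varW _))) (rowC u ys acc)))))) (firstThen (testT N))

    bitsC : ∀ {l} (xs : Vec (Vertex G) l) (ys : Vec (Vertex G) m) →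
      Computes fBits (encodeVec encV xs ∙ encodeVec encV ys)
        (encodeVec encodePair (Vec.concat (Vec.map (λ u → Vec.map (test G u) ys) xs))) (loop (loop (testT N) m) l)
    bitsC []       ys = loopEnd (consBranch (varW _) (nilBranch (varW _) nilW))
    bitsC {m} (x ∷ xs) ys = loopStep (consBranch (varW _) (consBranch (varW _)
      (callW (consW (varW _) (consW (varW _) (callW (consW (varW _) (varW _)) (bitsC xs ys))))
        (rowC x ys (Vec.concat (Vec.map (λ u → Vec.map (test G u) ys) xs)))))) (thenFirst (loop (testT N) m))

    badC : (xs : Vec (Vertex G) c) → Computes fBad (encodeVec encV xs) (encodeBool (f (bits G xs))) (badT N)
    badC xs = bounded (letW (callW (consW (varW _) (varW _)) (bitsC xs xs)) (treeW (c * c) f 0F (bits G xs) refl))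
      (firstThen (loop (loop (testT N) c) c))

    extendC : ∀ u (xss : List (Vec (Vertex G) m)) acc →
      Computes fExtend (encV u ∙ (encodeTuples G xss ∙ encodeTuples G acc))
        (encodeTuples G (List.map (u ∷_) xss ++ acc)) (loop 0 (length xss))
    extendC u []         acc = loopEnd (consBranch (varW _) (consBranch (varW _) (nilBranch (varW _) (varW _))))
    extendC u (xs ∷ xss) acc = loopStep (consBranch (varW _) (consBranch (varW _) (consBranch (varW _)
      (consW (consW (varW _) (varW _))
             (callW (consW (varW _) (consW (varW _) (varW _))) (extendC u xss acc)))))) only

    prodC : ∀ us (xss : List (Vec (Vertex G) m)) →
      Computes fProd (encodeList (List.map encV us) ∙ encodeTuples G xss)
        (encodeTuples G (cartesianProductWith _∷_ us xss)) (loop (loop 0 (length xss)) (length us))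
    prodC []       xss = loopEnd (consBranch (varW _) (nilBranch (varW _) nilW))
    prodC (u ∷ us) xss = loopStep (consBranch (varW _) (consBranch (varW _)
      (callW (consW (varW _) (consW (varW _) (callW (consW (varW _) (varW _)) (prodC us xss))))
        (extendC u xss (cartesianProductWith _∷_ us xss))))) (thenFirst (loop 0 (length xss)))

    tuplesW : ∀ {ρ : Vec Tree n} j →
      Within (encodeList (List.map encV (List.allFin N)) ∷ ρ) (tuplesE j) (encodeTuples G (tuples N j)) 0 (tuplesT N j ∷ [])
    tuplesW zero    = bounded (consW nilW nilW) z≤n
    tuplesW (suc j) = bounded (callW (consW (varW _) (tuplesW j)) (prodC (List.allFin N) (tuples N j)))
      (ℕ.+-monoʳ-≤ (tuplesT N j) (ℕ.≤-reflexive (trans (ℕ.+-identityʳ _)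
        (cong₂ (λ a b → loop (loop 0 a) b) (length-tuples N j) (length-tabulate {n = N} id)))))

    selectC : (xss : List (Vec (Vertex G) c)) →
      Computes fSelect (encodeTuples G xss) (encodeTuples G (filterᵇ (f ∘ bits G) xss)) (loop (badT N) (length xss))
    selectC []         = loopEnd (nilBranch (varW _) nilW)
    selectC (xs ∷ xss) with f (bits G xs) | badC xs
    ... | false | bad = loopStep (consBranch (varW _) (nilBranch (callW (varW _) bad)
      (callW (varW _) (selectC xss)))) (firstThen (badT N))
    ... | true  | bad = loopStep (consBranch (varW _) (consBranch (callW (varW _) bad)
      (consW (varW _) (callW (varW _) (selectC xss))))) (firstThen (badT N))

    memC : ∀ u (xs : Vec (Vertex G) m) →
      Computes fMem (encV u ∙ encodeVec encV xs) (encodeBool (u ∈ᵇ xs)) (loop (testT N) m)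
    memC u []       = loopEnd (consBranch (varW _) (nilBranch (varW _) (boolW false)))
    memC u (x ∷ xs) with toℕ u ≡ᵇ toℕ x | testC u x
    ... | false | t = loopStep (consBranch (varW _) (consBranch (varW _) (consBranch (callW (consW (varW _) (varW _)) t)
      (nilBranch (varW _) (callW (consW (varW _) (varW _)) (memC u xs)))))) (firstThen (testT N))
    ... | true  | t = loopStep (consBranch (varW _) (consBranch (varW _) (consBranch (callW (consW (varW _) (varW _)) t)
      (consBranch (varW _) (boolW true))))) (ℕ.+-monoʳ-≤ (testT N) z≤n)

    dropC : ∀ u (xss : List (Vec (Vertex G) m)) →
      Computes fDrop (encV u ∙ encodeTuples G xss) (encodeTuples G (drop u xss)) (loop (loop (testT N) m) (length xss))
    dropC u [] = loopEnd (consBranch (varW _) (nilBranch (varW _) nilW))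
    dropC {m} u (xs ∷ xss) with u ∈ᵇ xs | memC u xs
    ... | false | t = loopStep (consBranch (varW _) (consBranch (varW _) (nilBranch (callW (consW (varW _) (varW _)) t)
      (consW (varW _) (callW (consW (varW _) (varW _)) (dropC u xss)))))) (firstThen (loop (testT N) m))
    ... | true  | t = loopStep (consBranch (varW _) (consBranch (varW _) (consBranch (callW (consW (varW _) (varW _)) t)
      (callW (consW (varW _) (varW _)) (dropC u xss))))) (firstThen (loop (testT N) m))

    solveC : ∀ k (xss : List (Vec (Vertex G) c)) → length xss ≤ N ^ c →
      Computes fSolve (encodeTuples G xss ∙ encodeℕ k) (encodeBool (hittable k xss)) (solveT N k)
    tryC : ∀ k (xs : Vec (Vertex G) m) (xss : List (Vec (Vertex G) c)) → length xss ≤ N ^ c →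
      Computes fTry (encodeVec encV xs ∙ (encodeTuples G xss ∙ encodeℕ k))
        (encodeBool (anyᵇ (λ u → hittable k (drop u xss)) xs)) (tryT N m (solveT N k))

    solveC zero    []         len = bounded (consBranch (varW _) (nilBranch (varW _) (boolW true))) z≤n
    solveC (suc k) []         len = bounded (consBranch (varW _) (nilBranch (varW _) (boolW true))) z≤n
    solveC zero    (xs ∷ xss) len = bounded (consBranch (varW _) (consBranch (varW _) (nilBranch (varW _) (boolW false)))) z≤n
    solveC (suc k) (xs ∷ xss) len = bounded (consBranch (varW _) (consBranch (varW _) (consBranch (varW _)
      (callW (consW (varW _) (consW (varW _) (varW _))) (tryC k xs (xs ∷ xss) len))))) only

    tryC k []       xss len = bounded (consBranch (varW _) (consBranch (varW _) (nilBranch (varW _) nilW))) z≤n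
    tryC {suc m} k (x ∷ xs) xss len
      with hittable k (drop x xss)
         | solveC k (drop x xss) (ℕ.≤-trans (length-filter (λ ys → Bool.T? (not (x ∈ᵇ ys))) xss) len)
    ... | false | t = bounded (consBranch (varW _) (consBranch (varW _) (consBranch (varW _)
        (nilBranch (callW (consW (callW (consW (varW _) (varW _)) (dropC x xss)) (varW _)) t)
          (callW (consW (varW _) (consW (varW _) (varW _))) (tryC k xs xss len))))))
      (begin
        loop (loop (testT N) c) (length xss) + (solveT N k + (tryT N m (solveT N k) + 0))
          ≡⟨ ℕ.+-assoc (loop (loop (testT N) c) (length xss)) _ _ ⟨
        loop (loop (testT N) c) (length xss) + solveT N k + (tryT N m (solveT N k) + 0)
          ≤⟨ ℕ.+-mono-≤ (ℕ.+-monoˡ-≤ _ (loop-monoʳ len)) only ⟩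
        dropT N + solveT N k + tryT N m (solveT N k) ∎)
      where open ℕ.≤-Reasoning
    ... | true  | t = bounded (consBranch (varW _) (consBranch (varW _) (consBranch (varW _)
        (consBranch (callW (consW (callW (consW (varW _) (varW _)) (dropC x xss)) (varW _)) t) (boolW true)))))
      (begin
        loop (loop (testT N) c) (length xss) + (solveT N k + 0)
          ≤⟨ ℕ.+-mono-≤ (loop-monoʳ len) only ⟩
        dropT N + solveT N k
          ≤⟨ ℕ.m≤m+n _ _ ⟩
        dropT N + solveT N k + tryT N m (solveT N k) ∎)
      where open ℕ.≤-Reasoning

------------------------------------------------------------------------
-- Correctness of the branching

T⇒≡ : ∀ {b} → T b → b ≡ true
T⇒≡ = Equivalence.to Bool.T-≡

≡⇒T : ∀ {b} → b ≡ true → T b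
≡⇒T = Equivalence.from Bool.T-≡

anyᵇ-sound : ∀ {A : Set} {p : A → Bool} (xs : Vec A m) → anyᵇ p xs ≡ true → ∃ λ i → p (lookup xs i) ≡ true
anyᵇ-sound {p = p} (x ∷ xs) eq with p x in px
... | true  = zero , px
... | false = let i , eq′ = anyᵇ-sound xs eq in suc i , eq′

anyᵇ-complete : ∀ {A : Set} {p : A → Bool} (xs : Vec A m) i → p (lookup xs i) ≡ true → anyᵇ p xs ≡ true
anyᵇ-complete         (x ∷ xs) zero    eq rewrite eq = refl
anyᵇ-complete {p = p} (x ∷ xs) (suc i) eq =
  trans (cong (p x ∨_) (anyᵇ-complete xs i eq)) (Bool.∨-zeroʳ (p x))

-- insert x p is p with x added.
insert : Fin n → Subset n → Subset n
insert zero    (_ ∷ p) = inside ∷ p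
insert (suc x) (b ∷ p) = b ∷ insert x p

∣insert∣≤ : ∀ (x : Fin n) p → ∣ insert x p ∣ ≤ suc ∣ p ∣
∣insert∣≤ zero    (inside  ∷ p) = ℕ.n≤1+n _
∣insert∣≤ zero    (outside ∷ p) = ℕ.≤-refl
∣insert∣≤ (suc x) (inside  ∷ p) = s≤s (∣insert∣≤ x p)
∣insert∣≤ (suc x) (outside ∷ p) = ∣insert∣≤ x p

x∈insert : ∀ (x : Fin n) p → x ∈ insert x p
x∈insert zero    (_ ∷ p) = Vec.here
x∈insert (suc x) (_ ∷ p) = Vec.there (x∈insert x p)

⊆insert : ∀ (x : Fin n) {p y} → y ∈ p → y ∈ insert x p
⊆insert zero    Vec.here        = Vec.here
⊆insert zero    (Vec.there y∈p) = Vec.there y∈p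
⊆insert (suc x) Vec.here        = Vec.here
⊆insert (suc x) (Vec.there y∈p) = Vec.there (⊆insert x y∈p)

-- Some entry of xs is in S.
Hits : Subset n → Vec (Fin n) m → Set
Hits S xs = ∃ λ i → lookup xs i ∈ S

hittable-sound : ∀ k (F : List (Vec (Fin n) m)) → hittable k F ≡ true →
                 ∃ λ S → ∣ S ∣ ≤ k × (∀ {xs} → xs ∈ˡ F → Hits S xs)
hittable-sound {n} k [] eq = Vec.replicate n outside , subst (_≤ k) (sym (∣⊥∣≡0 n)) z≤n , λ ()
hittable-sound (suc k) F@(x ∷ xs) eq with anyᵇ-sound x eq
... | i , eq′ with hittable-sound k (drop (lookup x i) F) eq′
...   | S , S≤k , hits = insert u S , ℕ.≤-trans (∣insert∣≤ u S) (s≤s S≤k) , hits′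
  where
  u = lookup x i
  -- A tuple that contains u is hit by u; the others remain after the deletion.
  hits′ : ∀ {ys} → ys ∈ˡ F → Hits (insert u S) ys
  hits′ {ys} ys∈F with u ∈ᵇ ys in u∈ys
  ... | true  = let j , eq″ = anyᵇ-sound ys u∈ys in
                j , subst (_∈ insert u S) (≡ᵇ⇒≡ eq″) (x∈insert u S)
  ... | false = let j , ys[j]∈S = hits (∈-filter⁺ (λ zs → Bool.T? (not (u ∈ᵇ zs))) ys∈F
                                          (subst (T ∘ not) (sym u∈ys) _))
                in j , ⊆insert u ys[j]∈S

hittable-complete : ∀ k (F : List (Vec (Fin n) m)) S → ∣ S ∣ ≤ k → (∀ {xs} → xs ∈ˡ F → Hits S xs) →
                    hittable k F ≡ true
hittable-complete k       []       S S≤k hits = refl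
hittable-complete zero    (x ∷ xs) S S≤0 hits =
  contradiction (ℕ.≤-trans (x∈p⇒∣p-x∣<∣p∣ (proj₂ (hits (here refl)))) S≤0) λ ()
hittable-complete (suc k) F@(x ∷ xs) S S≤k hits with hits (here refl)
... | i , u∈S = anyᵇ-complete x i (hittable-complete k (drop u F) (S Subset.- u)
        (ℕ.≤-pred (ℕ.≤-trans (x∈p⇒∣p-x∣<∣p∣ u∈S) S≤k)) hits′)
  where
  u = lookup x i
  -- A tuple that does not contain u is hit by another element of S.
  hits′ : ∀ {ys} → ys ∈ˡ drop u F → Hits (S Subset.- u) ys
  hits′ {ys} ys∈ with ∈-filter⁻ (λ zs → Bool.T? (not (u ∈ᵇ zs))) {xs = F} ys∈
  ... | ys∈F , u∉ys with hits ys∈F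
  ...   | j , v∈S = j , x∈p∧x≢y⇒x∈p-y v∈S λ v≡u →
    subst (T ∘ not) (anyᵇ-complete ys j (≡⇒≡ᵇ (sym v≡u))) u∉ys

∈-tuples : ∀ (xs : Vec (Fin n) m) → xs ∈ˡ tuples n m
∈-tuples []       = here refl
∈-tuples (x ∷ xs) = ∈-cartesianProductWith⁺ _∷_ (∈-allFin x) (∈-tuples xs)

fromBits : Vec (Bool × Bool) (m * m) → Pattern m
fromBits bs i j = lookup bs (combine i j)

bits-represents : ∀ G (xs : Vec (Vertex G) m) → Represents G (lookup xs) (fromBits (bits G xs))
bits-represents G xs i j = trans (lookup-concat (Vec.map (λ u → Vec.map (test G u) xs) xs) i j)
  (trans (cong (λ ys → lookup ys j) (lookup-map i (λ u → Vec.map (test G u) xs) xs))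
         (lookup-map j (test G (lookup xs i)) xs))

------------------------------------------------------------------------
-- Polynomial bounds

-- The base is at least 2, so that constants are polynomial for n < 2 as well.
Polynomial : (ℕ → ℕ) → Set
Polynomial f = ∃ λ e → ∀ n → f n ≤ (2 ⊔ n) ^ e

base-nonZero : ∀ n → NonZero (2 ⊔ n)
base-nonZero n = >-nonZero (ℕ.≤-trans (s≤s z≤n) (ℕ.m≤m⊔n 2 n))

poly-id : Polynomial (λ n → n)
poly-id = 1 , λ n → ℕ.≤-trans (ℕ.m≤n⊔m 2 n) (ℕ.≤-reflexive (sym (ℕ.*-identityʳ _)))

poly-const : ∀ k → Polynomial (λ _ → k)
poly-const k = k , λ n → ℕ.≤-trans (n≤2^n k) (ℕ.^-monoˡ-≤ k (ℕ.m≤m⊔n 2 n))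
  where
  n≤2^n : ∀ n → n ≤ 2 ^ n
  n≤2^n zero    = z≤n
  n≤2^n (suc n) = ℕ.+-mono-≤ (ℕ.m^n>0 2 n) (ℕ.≤-trans (n≤2^n n) (ℕ.m≤m+n _ _))

poly-* : ∀ {f g} → Polynomial f → Polynomial g → Polynomial (λ n → f n * g n)
poly-* (a , p) (b , q) = a + b , λ n →
  ℕ.≤-trans (ℕ.*-mono-≤ (p n) (q n)) (ℕ.≤-reflexive (sym (ℕ.^-distribˡ-+-* (2 ⊔ n) a b)))

poly-+ : ∀ {f g} → Polynomial f → Polynomial g → Polynomial (λ n → f n + g n)
poly-+ {f} {g} (a , p) (b , q) = suc (a + b) , λ n → let instance _ = base-nonZero n in begin
  f n + g n                                    ≤⟨ ℕ.+-mono-≤ (p n) (q n) ⟩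
  (2 ⊔ n) ^ a + (2 ⊔ n) ^ b
    ≤⟨ ℕ.+-mono-≤ (ℕ.^-monoʳ-≤ (2 ⊔ n) (ℕ.m≤m+n a b)) (ℕ.^-monoʳ-≤ (2 ⊔ n) (ℕ.m≤n+m b a)) ⟩
  (2 ⊔ n) ^ (a + b) + (2 ⊔ n) ^ (a + b)        ≡⟨ cong ((2 ⊔ n) ^ (a + b) +_) (sym (ℕ.+-identityʳ _)) ⟩
  2 * (2 ⊔ n) ^ (a + b)                        ≤⟨ ℕ.*-monoˡ-≤ _ (ℕ.m≤m⊔n 2 n) ⟩
  (2 ⊔ n) ^ suc (a + b)                        ∎
  where open ℕ.≤-Reasoning

poly-^ : ∀ {f} k → Polynomial f → Polynomial (λ n → f n ^ k)
poly-^ zero    p = poly-const 1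
poly-^ (suc k) p = poly-* p (poly-^ k p)

poly-loop : ∀ {f g} → Polynomial f → Polynomial g → Polynomial (λ n → loop (f n) (g n))
poly-loop {f} {g} p q =
  let e , r = poly-* (poly-+ (poly-const 1) q) (poly-+ (poly-const overhead) p)
  in e , λ n → ℕ.≤-trans (ℕ.≤-reflexive (loop-unfold (f n) (g n))) (r n)

------------------------------------------------------------------------
-- The running time of the whole program

module Analysis (c : ℕ) (f : Vec (Bool × Bool) (c * c) → Bool) .{{_ : NonZero c}} where
  open Algorithm c f
  open Bounds bodies

  -- The answer of the program.
  answer : Graph → ℕ → Bool
  answer G k = (order G ≤ᵇ k) ∨ hittable k (filterᵇ (f ∘ bits G) (tuples (order G) c))

  -- Listing the vertices and the tuples, and selecting the bad ones.
  setupT : ℕ → ℕ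
  setupT n = loop 0 n + tuplesT n c + loop (badT n) (n ^ c)

  -- The work at one node of the search tree, without its subtrees.
  branchT : ℕ → ℕ
  branchT n = overhead + overhead + c * (overhead + dropT n)

  tryT-unfold : ∀ n m S → tryT n m S ≡ m * (overhead + dropT n + S) + overhead
  tryT-unfold n zero    S = ℕ.+-identityʳ overhead
  tryT-unfold n (suc m) S = trans (cong (λ t → overhead + (dropT n + S + t)) (tryT-unfold n m S))
    (solve 4 (λ o d s t → o :+ (d :+ s :+ (t :+ o)) := o :+ d :+ s :+ t :+ o) refl
       overhead (dropT n) S (m * (overhead + dropT n + S)))
    where open +-*-Solver

  1≤c^ : ∀ k → 1 ≤ c ^ k
  1≤c^ = ℕ.m^n>0 c

  -- The recurrence is solveT (k + 1) = branchT + c * solveT k.  Its solution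
  -- needs 1 ≤ c, which bounds the additive term by a multiple of c ^ (k + 1).
  solveT-bound : ∀ n k → solveT n k ≤ suc k * branchT n * c ^ k
  solveT-bound n zero    = begin
    overhead + 0                     ≤⟨ ℕ.+-monoʳ-≤ overhead z≤n ⟩
    overhead + (overhead + c * (overhead + dropT n))        ≡⟨ ℕ.+-assoc overhead overhead _ ⟨
    branchT n                        ≡⟨ solve 1 (λ b → b := (b :+ con 0) :* con 1) refl (branchT n) ⟩
    suc 0 * branchT n * c ^ 0        ∎
    where open ℕ.≤-Reasoning
          open +-*-Solver
  solveT-bound n (suc k) = begin
    overhead + tryT n c (solveT n k)
      ≡⟨ cong (overhead +_) (tryT-unfold n c (solveT n k)) ⟩
    overhead + (c * (overhead + dropT n + solveT n k) + overhead)
      ≡⟨ solve 4 (λ o c d s → o :+ (c :* (o :+ d :+ s) :+ o) := o :+ o :+ c :* (o :+ d) :+ c :* s) refl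
           overhead c (dropT n) (solveT n k) ⟩
    branchT n + c * solveT n k
      ≤⟨ ℕ.+-mono-≤ (ℕ.≤-reflexive (sym (ℕ.*-identityʳ _))) (ℕ.*-monoʳ-≤ c (solveT-bound n k)) ⟩
    branchT n * 1 + c * (suc k * branchT n * c ^ k)
      ≤⟨ ℕ.+-monoˡ-≤ _ (ℕ.*-monoʳ-≤ (branchT n) (1≤c^ (suc k))) ⟩
    branchT n * (c * c ^ k) + c * (suc k * branchT n * c ^ k)
      ≡⟨ solve 4 (λ b c p k → b :* (c :* p) :+ c :* ((con 1 :+ k) :* b :* p) := (con 2 :+ k) :* b :* (c :* p)) refl
           (branchT n) c (c ^ k) k ⟩
    suc (suc k) * branchT n * c ^ suc k
      ∎
    where open ℕ.≤-Reasoning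
          open +-*-Solver

  -- The bound with the factor c ^ k removed; k + 1 is replaced by n.
  totalT : ℕ → ℕ
  totalT n = overhead + (loop 0 n + setupT n + n * branchT n)

  poly-test : Polynomial testT
  poly-test = poly-+ (poly-const overhead) (poly-+ line line)
    where line = poly-loop (poly-const 0) poly-id

  poly-tuplesT : ∀ j → Polynomial (λ n → tuplesT n j)
  poly-tuplesT zero    = poly-const (overhead + 0)
  poly-tuplesT (suc j) = poly-+ (poly-const overhead)
    (poly-+ (poly-tuplesT j) (poly-loop (poly-loop (poly-const 0) (poly-^ j poly-id)) poly-id))

  poly-setup : Polynomial setupT
  poly-setup = poly-+ (poly-+ (poly-loop (poly-const 0) poly-id) (poly-tuplesT c))
    (poly-loop (poly-+ (poly-const overhead) (poly-+ (poly-loop (poly-loop poly-test (poly-const c)) (poly-const c))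
        (poly-const (loop 0 (c * c)))))
      (poly-^ c poly-id))

  poly-branch : Polynomial branchT
  poly-branch = poly-+ (poly-const (overhead + overhead)) (poly-* (poly-const c)
    (poly-+ (poly-const overhead) (poly-loop (poly-loop poly-test (poly-const c)) (poly-^ c poly-id))))

  poly-total : Polynomial totalT
  poly-total = poly-+ (poly-const overhead)
    (poly-+ (poly-+ (poly-loop (poly-const 0) poly-id) poly-setup) (poly-* poly-id poly-branch))

  module _ (G : Graph) (k : ℕ) where

    private
      N : ℕ
      N = order G
      rows : List Tree
      rows = List.tabulate λ u → encodeList (List.tabulate λ v → encodeBool (adj G u v))

    vertices-≡ : encodeList (List.tabulate (encodeVertex G)) ≡ encodeList (List.map (encodeVertex G) (List.allFin N))
    vertices-≡ = cong encodeList (sym (map-tabulate id (encodeVertex G)))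

    compareC : Computes fLe (encodeGraph G ∙ encodeℕ k) (encodeBool (N ≤ᵇ k)) (loop 0 N)
    compareC = subst (λ l → Computes fLe (encodeGraph G ∙ encodeℕ k) (encodeBool (l ≤ᵇ k)) (loop 0 l))
      (length-tabulate (λ u → encodeList (List.tabulate λ v → encodeBool (adj G u v)))) (leC rows k)

    verticesC : Computes fTokens (nil ∙ encodeGraph G) (encodeList (List.map (encodeVertex G) (List.allFin N))) (loop 0 N)
    verticesC = subst (λ v → Computes fTokens (nil ∙ encodeGraph G) v (loop 0 N)) vertices-≡
      (tokensC 0 (λ u → encodeList (List.tabulate λ v → encodeBool (adj G u v))) toℕ λ _ → refl)

    all : List (Vec (Vertex G) c)
    all = tuples N c

    runs : Within (encodeInstance (G , k) ∷ []) (Program.main program) (encodeBool (answer G k)) 0 (c ^ k * totalT N ∷ [])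
    runs with N ≤ᵇ k in N≤k | compareC
    ... | true | t = enlarge (bounded (consBranch (varW _) (consBranch (callW (consW (varW _) (varW _)) t) (boolW true))) only)
      (begin
        overhead + loop 0 N                                       ≤⟨ ℕ.+-monoʳ-≤ overhead (ℕ.≤-trans (ℕ.m≤m+n _ _) (ℕ.m≤m+n _ _)) ⟩
        totalT N                                                  ≡⟨ ℕ.*-identityˡ _ ⟨
        1 * totalT N                                              ≤⟨ ℕ.*-monoˡ-≤ (totalT N) (1≤c^ k) ⟩
        c ^ k * totalT N                                          ∎)
      where open ℕ.≤-Reasoning
    ... | false | t = enlarge
      (bounded (consBranch (varW _) (nilBranch (callW (consW (varW _) (varW _)) t)
        (callW (consW (callW (letW (callW (consW nilW (varW _)) verticesC) (tuplesW G c)) (selectC G all)) (varW _))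
          (solveC G k (filterᵇ (f ∘ bits G) all) short)))) ℕ.≤-refl)
      (begin
        overhead + (loop 0 N + (loop 0 N + (tuplesT N c + (loop (badT N) (length all) + (solveT N k + 0)))))
          ≡⟨ cong (λ l → overhead + (loop 0 N + (loop 0 N + (tuplesT N c + (loop (badT N) l + (solveT N k + 0))))))
               (length-tuples N c) ⟩
        overhead + (loop 0 N + (loop 0 N + (tuplesT N c + (loop (badT N) (N ^ c) + (solveT N k + 0)))))
          ≡⟨ solve 5 (λ o a b d s → o :+ (a :+ (a :+ (b :+ (d :+ (s :+ con 0))))) := o :+ (a :+ (a :+ b :+ d)) :+ s) refl
               overhead (loop 0 N) (tuplesT N c) (loop (badT N) (N ^ c)) (solveT N k) ⟩
        overhead + (loop 0 N + setupT N) + solveT N k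
          ≤⟨ ℕ.+-mono-≤ (ℕ.m≤n*m _ (c ^ k) {{ℕ.m^n≢0 c k}})
               (ℕ.≤-trans (solveT-bound N k) (ℕ.*-monoˡ-≤ (c ^ k) (ℕ.*-monoˡ-≤ (branchT N) k<N))) ⟩
        c ^ k * (overhead + (loop 0 N + setupT N)) + N * branchT N * c ^ k
          ≡⟨ solve 5 (λ p o a b d → p :* (o :+ (a :+ b)) :+ d :* p := p :* (o :+ (a :+ b :+ d))) refl
               (c ^ k) overhead (loop 0 N) (setupT N) (N * branchT N) ⟩
        c ^ k * totalT N ∎)
      where
      open ℕ.≤-Reasoning
      open +-*-Solver
      k<N : k < N
      k<N = ℕ.≰⇒> λ N≤k′ → subst T N≤k (ℕ.≤⇒≤ᵇ N≤k′)
      short : length (filterᵇ (f ∘ bits G) all) ≤ N ^ c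
      short = ℕ.≤-trans (length-filter (Bool.T? ∘ f ∘ bits G) all) (ℕ.≤-reflexive (length-tuples N c))

------------------------------------------------------------------------
-- Correctness of the algorithm

module _ {ℓ₁ ℓ₂} (Π₁ : GraphClass ℓ₁) (Π₂ : GraphClass ℓ₂) {𝓕₁ 𝓕₂ : List Graph}
  (hereditary₁ : Hereditary Π₁) (hereditary₂ : Hereditary Π₂)
  (forbidden₁ : IsForbiddenFamily Π₁ 𝓕₁) (forbidden₂ : IsForbiddenFamily Π₂ 𝓕₂)
  (connected₁ : All Connected 𝓕₁) (connected₂ : All Connected 𝓕₂)
  {α d₁ d₂} (path∈ : path α ∈≅ 𝓕₁)
  (≤d₁ : All (λ H → order H ≤ d₁) 𝓕₁) (≤d₂ : All (λ H → order H ≤ d₂) 𝓕₂)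
  {c} (small : d₁ + d₂ + α ∸ 2 ≤ c) .{{_ : NonZero c}} where

  pattern? : (bs : Vec (Bool × Bool) (c * c)) → Dec (Bad 𝓕₁ 𝓕₂ (fromBits {c} bs))
  pattern? bs = bad? 𝓕₁ 𝓕₂ (fromBits {c} bs)

  decideBad : Vec (Bool × Bool) (c * c) → Bool
  decideBad bs = does (pattern? bs)

  open Analysis c decideBad

  badTuples : ∀ G → List (Vec (Vertex G) c)
  badTuples G = filterᵇ (decideBad ∘ bits G) (tuples (order G) c)

  deletion⇒hits : ∀ G S → EachComponent (λ H → Π₁ H ⊎ Π₂ H) (G - S) → ∀ {xs} → xs ∈ˡ badTuples G → Hits S xs
  deletion⇒hits G S each {xs} xs∈ =
    each⇒hit Π₁ Π₂ hereditary₁ hereditary₂ forbidden₁ forbidden₂ G S each (fromℕ< (>-nonZero⁻¹ c)) (bits-represents G xs)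
      (does-true (pattern? (bits G xs))
        (T⇒≡ (proj₂ (∈-filter⁻ (Bool.T? ∘ decideBad ∘ bits G) {xs = tuples (order G) c} xs∈))))

  hits⇒deletion : ∀ G S → (∀ {xs} → xs ∈ˡ badTuples G → Hits S xs) → EachComponent (λ H → Π₁ H ⊎ Π₂ H) (G - S)
  hits⇒deletion G S hits =
    hit⇒each Π₁ Π₂ hereditary₁ hereditary₂ forbidden₁ forbidden₂ connected₁ connected₂ path∈ ≤d₁ ≤d₂ small G S λ x bad →
      let xs = Vec.tabulate x
          x≗xs : ∀ i → lookup xs i ≡ x i
          x≗xs = lookup∘tabulate x
          pattern-bad = bad (fromBits {c} (bits G xs)) λ i j → trans (bits-represents G xs i j) (cong₂ (test G) (x≗xs i) (x≗xs j))
          i , xi∈S = hits (∈-filter⁺ (Bool.T? ∘ decideBad ∘ bits G) (∈-tuples xs)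
                             (≡⇒T (dec-true (pattern? (bits G xs)) pattern-bad)))
      in i , subst (_∈ S) (x≗xs i) xi∈S

  -- If n ≤ k, all vertices can be deleted, and the empty graph has no component.
  answer-reflects : ∀ G k → Reflects (HasDeletionSet Π₁ Π₂ (G , k)) (answer G k)
  answer-reflects G k with order G ≤ᵇ k in n≤k
  ... | true  = ofʸ (⊤ , subst (_≤ k) (sym (∣⊤∣≡n (order G))) (ℕ.≤ᵇ⇒≤ (order G) k (≡⇒T n≤k)) ,
      λ { C (v , _) → ⊥-elim (x∈∁p⇒x∉p (element-∈ (∁ (⊤ {order G})) v) ∈⊤) })
  ... | false with hittable k (badTuples G) in eq
  ...   | true  = let S , S≤k , hits = hittable-sound k (badTuples G) eq
                  in ofʸ (S , S≤k , hits⇒deletion G S hits)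
  ...   | false = ofⁿ λ { (S , S≤k , each) → contradiction
      (trans (sym eq) (hittable-complete k (badTuples G) S S≤k (deletion⇒hits G S each))) λ () }

  decides : ∃[ p ] ∃[ e ] DecidesInTime encodeInstance p (HasDeletionSet Π₁ Π₂)
    (λ (G , k) → c ^ k * (2 ⊔ order G) ^ e)
  decides = Algorithm.program c decideBad , proj₁ poly-total , λ (G , k) →
    let open Bounds.Within (runs G k)
    in answer G k , time , eval ,
       ℕ.≤-trans bound (ℕ.≤-trans (ℕ.≤-reflexive (ℕ.+-identityʳ _)) (ℕ.*-monoʳ-≤ (c ^ k) (proj₂ poly-total (order G)))) ,
       answer-reflects G k

vertex⇒0<order : ∀ G → Vertex G → 0 < order G
vertex⇒0<order G v = ℕ.≤-trans (s≤s z≤n) (toℕ<n v)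

connected⇒0<max : ∀ {𝓕 d} → All Connected 𝓕 → IsMaxOrder 𝓕 d → 0 < d
connected⇒0<max conns (attained , _) with find attained
... | H , H∈𝓕 , refl = vertex⇒0<order H (proj₁ (All.lookup conns H∈𝓕))

connected⇒0<path : ∀ {𝓕 α} → All Connected 𝓕 → path α ∈≅ 𝓕 → 0 < α
connected⇒0<path {α = α} conns path∈ with find path∈
... | H , H∈𝓕 , iso , _ = vertex⇒0<order (path α) (Inverse.from iso (proj₁ (All.lookup conns H∈𝓕)))

theorem1 : ∀ {ℓ₁ ℓ₂} (Π₁ : GraphClass ℓ₁) (Π₂ : GraphClass ℓ₂) (𝓕₁ 𝓕₂ : List Graph) →
    Hereditary Π₁ → Hereditary Π₂ →
    IsForbiddenFamily Π₁ 𝓕₁ → IsForbiddenFamily Π₂ 𝓕₂ →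
    All Connected 𝓕₁ → All Connected 𝓕₂ →
    (α : ℕ) → path α ∈≅ 𝓕₁ →
    (d₁ d₂ : ℕ) → IsMaxOrder 𝓕₁ d₁ → IsMaxOrder 𝓕₂ d₂ →
    let c = d₁ + d₂ + α ∸ 2 in
    ∃[ p ] ∃[ e ] DecidesInTime encodeInstance p (HasDeletionSet Π₁ Π₂)
    (λ (G , k) → c ^ k * (2 ⊔ Graph.order G) ^ e)
theorem1 Π₁ Π₂ 𝓕₁ 𝓕₂ hereditary₁ hereditary₂ forbidden₁ forbidden₂ connected₁ connected₂ α path∈ d₁ d₂ max₁ max₂ =
  decides Π₁ Π₂ hereditary₁ hereditary₂ forbidden₁ forbidden₂ connected₁ connected₂ path∈ (proj₂ max₁) (proj₂ max₂) ℕ.≤-refl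
    {{>-nonZero (ℕ.m+n≤o⇒m≤o∸n 1 (ℕ.+-mono-≤ (ℕ.+-mono-≤ (connected⇒0<max connected₁ max₁) (connected⇒0<max connected₂ max₂))
                                              (connected⇒0<path connected₁ path∈)))}}
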